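{- For $n\in\mathbb{N}$, $\mathcal{R}_n = \left(\frac{\pi}{2}-1\right)n+O\left(\sqrt{n}\right)$, and hence $\lim_{n\to\infty}\frac{1}{n}\mathcal{R}_n=\frac{\pi}{2}-1$.
   Context: $\mathbb{N}$ denotes the set of positive integers. The nearest integer function $\mathrm{nint}$ rounds a real number to the nearest integer, with half-integers rounded up: $\mathrm{nint}(x)=\max\{z\in\mathbb{Z} : |z-x|\le |z'-x|\text{ for all } z'\in\mathbb{Z}\}=\lfloor x+1/2\rfloor$. For $n\in\mathbb{N}$, $\mathcal{R}_n = \#\{k\in\mathbb{Z} : 1\le k\le n,\ \mathrm{nint}(n/k)\text{ is odd}\}$. Big O notation: $f(n)=O(g(n))$ means there exist constants $M$ and $a$ such that $|f(n)|\le M g(n)$ for all $n\ge a$. -}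

module Defs where

open import Data.Integer.Base as ℤ using (ℤ; +_; -[1+_])
import Data.Integer.Properties as ℤ
import Data.Integer.Divisibility.Signed as ℤ
open import Data.List.Base using (length; filter; upTo; applyUpTo)
open import Data.Nat.Base as ℕ using (ℕ; zero; suc; NonZero)
import Data.Nat.DivMod as ℕ
open import Data.Nat.ListAction using (sum)
import Data.Nat.Properties as ℕ
open import Data.Nat.Solver using (module +-*-Solver)
open import Data.Product.Base using (∃; ∃-syntax; _×_; _,_; proj₁; proj₂)
open import Data.Rational.Base as ℚ using (ℚ; mkℚ; 0ℚ; 1ℚ; ½)
import Data.Rational.Properties as ℚ
import Data.Rational.Solver as ℚ
open import Data.Rational.Unnormalised.Base as ℚᵘ using (mkℚᵘ)
import Data.Rational.Unnormalised.Properties as ℚᵘ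
open import Data.Sum.Base using (inj₁; inj₂)
open import Relation.Binary.PropositionalEquality
open import Relation.Nullary using (yes; no; ¬?; contradiction)

Cauchy : (ℕ → ℚ) → Set
Cauchy a = ∀ ε → 0ℚ ℚ.< ε →
  ∃[ N ] ∀ m n → N ℕ.≤ m → N ℕ.≤ n → ℚ.∣ a m ℚ.- a n ∣ ℚ.< ε

-- Elements of ℝ are representatives: x and y are the same real number
-- when x ≤ y and y ≤ x.
record ℝ : Set where
  constructor mkℝ
  field
    seq    : ℕ → ℚ
    cauchy : Cauchy seq

open ℝ public

infix 4 _≤_ _<_

_≤_ : ℝ → ℝ → Set
x ≤ y = ∀ ε → 0ℚ ℚ.< ε →
  ∃[ N ] ∀ n → N ℕ.≤ n → seq x n ℚ.≤ seq y n ℚ.+ ε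

_<_ : ℝ → ℝ → Set
x < y = ∃[ δ ] 0ℚ ℚ.< δ ×
  (∃[ N ] ∀ n → N ℕ.≤ n → seq x n ℚ.+ δ ℚ.≤ seq y n)

private
  0<½*_ : ∀ {ε} → 0ℚ ℚ.< ε → 0ℚ ℚ.< ½ ℚ.* ε
  0<½*_ {ε} 0<ε = subst (ℚ._< ½ ℚ.* ε) (ℚ.*-zeroʳ ½) (ℚ.*-monoʳ-<-pos ½ 0<ε)

  ½+½ : ∀ ε → ½ ℚ.* ε ℚ.+ ½ ℚ.* ε ≡ ε
  ½+½ ε = trans (sym (ℚ.*-distribʳ-+ ε ½ ½)) (ℚ.*-identityˡ ε)

  ≤-<-split : ∀ p q r {ε} → p ≡ q ℚ.+ r →
    ℚ.∣ q ∣ ℚ.< ½ ℚ.* ε → ℚ.∣ r ∣ ℚ.< ½ ℚ.* ε → ℚ.∣ p ∣ ℚ.< ε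
  ≤-<-split _ q r {ε} refl hq hr = subst (ℚ.∣ q ℚ.+ r ∣ ℚ.<_) (½+½ ε)
    (ℚ.≤-<-trans (ℚ.∣p+q∣≤∣p∣+∣q∣ q r) (ℚ.+-mono-< hq hr))

fromℚ : ℚ → ℝ
fromℚ q = mkℝ (λ _ → q) λ ε 0<ε →
  0 , λ _ _ _ _ → subst (λ r → ℚ.∣ r ∣ ℚ.< ε) (sym (ℚ.+-inverseʳ q)) 0<ε

fromℕ : ℕ → ℝ
fromℕ n = fromℚ (+ n ℚ./ 1)

infix  8 -_
infixl 7 _*_
infixl 6 _+_ _-_

_+_ : ℝ → ℝ → ℝ
x + y = mkℝ (λ n → seq x n ℚ.+ seq y n) λ ε 0<ε →
  let (N , hx) = cauchy x (½ ℚ.* ε) (0<½* 0<ε)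
      (P , hy) = cauchy y (½ ℚ.* ε) (0<½* 0<ε)
  in N ℕ.⊔ P , λ m n m≥ n≥ →
    ≤-<-split _ (seq x m ℚ.- seq x n) (seq y m ℚ.- seq y n)
      (rearrange (seq x m) (seq y m) (seq x n) (seq y n))
      (hx m n (ℕ.m⊔n≤o⇒m≤o N P m≥) (ℕ.m⊔n≤o⇒m≤o N P n≥))
      (hy m n (ℕ.m⊔n≤o⇒n≤o N P m≥) (ℕ.m⊔n≤o⇒n≤o N P n≥))
  where
  rearrange : ∀ a b c d →
    (a ℚ.+ b) ℚ.- (c ℚ.+ d) ≡ (a ℚ.- c) ℚ.+ (b ℚ.- d)
  rearrange = solve 4 (λ a b c d →
    (a :+ b) :- (c :+ d) := (a :- c) :+ (b :- d)) refl
    where open ℚ.+-*-Solver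

-_ : ℝ → ℝ
- x = mkℝ (λ n → ℚ.- seq x n) λ ε 0<ε →
  let (N , h) = cauchy x ε 0<ε
  in N , λ m n m≥ n≥ →
    subst (ℚ._< ε)
      (trans (sym (ℚ.∣-p∣≡∣p∣ (seq x m ℚ.- seq x n)))
        (cong ℚ.∣_∣ (ℚ.neg-distrib-+ (seq x m) (ℚ.- seq x n))))
      (h m n m≥ n≥)

_-_ : ℝ → ℝ → ℝ
x - y = x + (- y)

∣_∣ : ℝ → ℝ
∣ x ∣ = mkℝ (λ n → ℚ.∣ seq x n ∣) λ ε 0<ε →
  let (N , h) = cauchy x ε 0<ε
  in N , λ m n m≥ n≥ →
    ℚ.≤-<-trans (reverse-triangle (seq x m) (seq x n)) (h m n m≥ n≥)
  where
  one-sided : ∀ p q → ℚ.∣ p ∣ ℚ.- ℚ.∣ q ∣ ℚ.≤ ℚ.∣ p ℚ.- q ∣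
  one-sided p q = subst (ℚ.∣ p ∣ ℚ.- ℚ.∣ q ∣ ℚ.≤_) (cancel ℚ.∣ p ℚ.- q ∣ ℚ.∣ q ∣)
    (ℚ.+-monoˡ-≤ (ℚ.- ℚ.∣ q ∣)
      (subst (λ r → ℚ.∣ r ∣ ℚ.≤ ℚ.∣ p ℚ.- q ∣ ℚ.+ ℚ.∣ q ∣) (restore p q)
        (ℚ.∣p+q∣≤∣p∣+∣q∣ (p ℚ.- q) q)))
    where
    open ℚ.+-*-Solver
    cancel : ∀ a b → (a ℚ.+ b) ℚ.- b ≡ a
    cancel = solve 2 (λ a b → (a :+ b) :- b := a) refl
    restore : ∀ a b → (a ℚ.- b) ℚ.+ b ≡ a
    restore = solve 2 (λ a b → (a :- b) :+ b := a) refl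

  flip-∣-∣ : ∀ p q → ℚ.- (p ℚ.- q) ≡ q ℚ.- p
  flip-∣-∣ = solve 2 (λ p q → :- (p :- q) := q :- p) refl
    where open ℚ.+-*-Solver

  reverse-triangle : ∀ p q →
    ℚ.∣ ℚ.∣ p ∣ ℚ.- ℚ.∣ q ∣ ∣ ℚ.≤ ℚ.∣ p ℚ.- q ∣
  reverse-triangle p q with ℚ.∣p∣≡p∨∣p∣≡-p (ℚ.∣ p ∣ ℚ.- ℚ.∣ q ∣)
  ... | inj₁ eq = subst (ℚ._≤ ℚ.∣ p ℚ.- q ∣) (sym eq) (one-sided p q)
  ... | inj₂ eq = subst₂ ℚ._≤_
    (sym (trans eq (flip-∣-∣ ℚ.∣ p ∣ ℚ.∣ q ∣)))
    (trans (cong ℚ.∣_∣ (sym (flip-∣-∣ p q))) (ℚ.∣-p∣≡∣p∣ (p ℚ.- q)))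
    (one-sided q p)

private
  eventually-bounded : ∀ x → ∃[ B ] 0ℚ ℚ.< B ×
    (∃[ N ] ∀ n → N ℕ.≤ n → ℚ.∣ seq x n ∣ ℚ.≤ B)
  eventually-bounded x = let (N , h) = cauchy x 1ℚ (ℚ.positive⁻¹ 1ℚ) in
    1ℚ ℚ.+ ℚ.∣ seq x N ∣ ,
    ℚ.+-mono-<-≤ (ℚ.positive⁻¹ 1ℚ) (ℚ.0≤∣p∣ (seq x N)) ,
    N , λ n n≥ → ℚ.≤-trans
      (subst (λ r → ℚ.∣ r ∣ ℚ.≤ ℚ.∣ seq x n ℚ.- seq x N ∣ ℚ.+ ℚ.∣ seq x N ∣)
        (restore (seq x n) (seq x N))
        (ℚ.∣p+q∣≤∣p∣+∣q∣ (seq x n ℚ.- seq x N) (seq x N)))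
      (ℚ.+-monoˡ-≤ ℚ.∣ seq x N ∣ (ℚ.<⇒≤ (h n N n≥ ℕ.≤-refl)))
    where
    open ℚ.+-*-Solver
    restore : ∀ a b → (a ℚ.- b) ℚ.+ b ≡ a
    restore = solve 2 (λ a b → (a :- b) :+ b := a) refl

  tolerance : ∀ B ε → 0ℚ ℚ.< B → 0ℚ ℚ.< ε →
    ∃[ δ ] 0ℚ ℚ.< δ ×
      (∀ p q → ℚ.∣ p ∣ ℚ.≤ B → ℚ.∣ q ∣ ℚ.< δ → ℚ.∣ p ℚ.* q ∣ ℚ.< ½ ℚ.* ε)
  tolerance B ε 0<B 0<ε = δ , 0<δ , λ p q hp hq →
    subst₂ ℚ._<_ (sym (ℚ.∣p*q∣≡∣p∣*∣q∣ p q)) Bδ≡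
      (ℚ.≤-<-trans
        (ℚ.*-monoʳ-≤-nonNeg ℚ.∣ q ∣ {{ℚ.∣-∣-nonNeg q}} hp)
        (ℚ.*-monoʳ-<-pos B hq))
    where
    instance
      B>0 : ℚ.Positive B
      B>0 = ℚ.positive 0<B
      B≢0 : ℚ.NonZero B
      B≢0 = ℚ.pos⇒nonZero B
      ½ε>0 : ℚ.Positive (½ ℚ.* ε)
      ½ε>0 = ℚ.positive (0<½* 0<ε)
      1/B>0 : ℚ.Positive (ℚ.1/ B)
      1/B>0 = ℚ.1/pos⇒pos B
    δ : ℚ
    δ = (ℚ.1/ B) ℚ.* (½ ℚ.* ε)
    0<δ : 0ℚ ℚ.< δ
    0<δ = ℚ.positive⁻¹ δ {{ℚ.pos*pos⇒pos (ℚ.1/ B) (½ ℚ.* ε)}}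
    Bδ≡ : B ℚ.* δ ≡ ½ ℚ.* ε
    Bδ≡ = trans (sym (ℚ.*-assoc B (ℚ.1/ B) (½ ℚ.* ε)))
      (trans (cong (ℚ._* (½ ℚ.* ε)) (ℚ.*-inverseʳ B)) (ℚ.*-identityˡ _))

_*_ : ℝ → ℝ → ℝ
x * y = mkℝ (λ n → seq x n ℚ.* seq y n) λ ε 0<ε →
  let (B , 0<B , N₁ , hB) = eventually-bounded x
      (C , 0<C , N₂ , hC) = eventually-bounded y
      (δ , 0<δ , hδ)      = tolerance B ε 0<B 0<ε
      (η , 0<η , hη)      = tolerance C ε 0<C 0<ε
      (N₃ , hy)           = cauchy y δ 0<δ
      (N₄ , hx)           = cauchy x η 0<η
  in (N₁ ℕ.⊔ N₂) ℕ.⊔ (N₃ ℕ.⊔ N₄) , λ m n m≥ n≥ →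
    let (m≥₁₂ , m≥₃₄) = above (N₁ ℕ.⊔ N₂) (N₃ ℕ.⊔ N₄) m≥
        (n≥₁₂ , n≥₃₄) = above (N₁ ℕ.⊔ N₂) (N₃ ℕ.⊔ N₄) n≥
        (m≥₁ , _) = above N₁ N₂ m≥₁₂ ; (_ , n≥₂) = above N₁ N₂ n≥₁₂
        (m≥₃ , m≥₄) = above N₃ N₄ m≥₃₄ ; (n≥₃ , n≥₄) = above N₃ N₄ n≥₃₄ in
    ≤-<-split _
      (seq x m ℚ.* (seq y m ℚ.- seq y n)) (seq y n ℚ.* (seq x m ℚ.- seq x n))
      (rearrange (seq x m) (seq y m) (seq x n) (seq y n))
      (hδ _ _ (hB m m≥₁) (hy m n m≥₃ n≥₃))
      (hη _ _ (hC n n≥₂) (hx m n m≥₄ n≥₄))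
  where
  above : ∀ i j {k} → i ℕ.⊔ j ℕ.≤ k → i ℕ.≤ k × j ℕ.≤ k
  above i j h = ℕ.m⊔n≤o⇒m≤o i j h , ℕ.m⊔n≤o⇒n≤o i j h

  rearrange : ∀ a b c d →
    a ℚ.* b ℚ.- c ℚ.* d ≡ a ℚ.* (b ℚ.- d) ℚ.+ d ℚ.* (a ℚ.- c)
  rearrange = solve 4 (λ a b c d →
    a :* b :- c :* d := a :* (b :- d) :+ d :* (a :- c)) refl
    where open ℚ.+-*-Solver

Sequence : Set
Sequence = (n : ℕ) → .{{_ : NonZero n}} → ℝ

infix 4 _∈O_

_∈O_ : Sequence → Sequence → Set
f ∈O g = ∃[ M ] ∃[ a ] ∀ n .{{_ : NonZero n}} → a ℕ.≤ n → ∣ f n ∣ ≤ M * g n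

infix 4 _⟶_

_⟶_ : Sequence → ℝ → Set
f ⟶ l = ∀ ε → fromℕ 0 < ε →
  ∃[ N ] ∀ n .{{_ : NonZero n}} → N ℕ.≤ n → ∣ f n - l ∣ < ε

⌊√_⌋ : ℕ → ℕ
⌊√ zero ⌋ = 0
⌊√ suc n ⌋ with suc ⌊√ n ⌋ ℕ.* suc ⌊√ n ⌋ ℕ.≤? suc n
... | yes _ = suc ⌊√ n ⌋
... | no  _ = ⌊√ n ⌋

⌊√⌋-lower : ∀ n → ⌊√ n ⌋ ℕ.* ⌊√ n ⌋ ℕ.≤ n
⌊√⌋-lower zero = ℕ.z≤n
⌊√⌋-lower (suc n) with suc ⌊√ n ⌋ ℕ.* suc ⌊√ n ⌋ ℕ.≤? suc n
... | yes h = h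
... | no  _ = ℕ.m≤n⇒m≤1+n (⌊√⌋-lower n)

⌊√⌋-upper : ∀ n → n ℕ.< suc ⌊√ n ⌋ ℕ.* suc ⌊√ n ⌋
⌊√⌋-upper zero = ℕ.s≤s ℕ.z≤n
⌊√⌋-upper (suc n) with suc ⌊√ n ⌋ ℕ.* suc ⌊√ n ⌋ ℕ.≤? suc n
... | yes _ = ℕ.≤-<-trans (⌊√⌋-upper n)
  (ℕ.*-mono-< {suc ⌊√ n ⌋} (ℕ.n<1+n _) (ℕ.n<1+n _))
... | no  h = ℕ.≰⇒> h

private
  c/1+l<ε : ∀ c ε → 0ℚ ℚ.< ε → ∃[ N ] ∀ l → N ℕ.≤ l → + c ℚ./ suc l ℚ.< ε
  c/1+l<ε c (mkℚ (+ zero) _ _) (ℚ.*<* (ℤ.+<+ ()))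
  c/1+l<ε c (mkℚ -[1+ _ ] _ _) (ℚ.*<* ())
  c/1+l<ε c ε@(mkℚ (+ suc p) d _) _ = c ℕ.* suc d , λ l cd≤l →
    ℚ.toℚᵘ-cancel-< (ℚᵘ.<-respˡ-≃
      (ℚᵘ.≃-sym {x = ℚ.toℚᵘ (+ c ℚ./ suc l)} (ℚ.toℚᵘ-fromℚᵘ (mkℚᵘ (+ c) l)))
      (ℚᵘ.*<* (subst₂ ℤ._<_ (ℤ.pos-* c (suc d)) (ℤ.pos-* (suc p) (suc l))
        (ℤ.+<+ (ℕ.<-≤-trans (ℕ.s≤s cd≤l) (ℕ.m≤m+n (suc l) (p ℕ.* suc l)))))))

  cauchy-by : ∀ a c → (∀ k l → a k ℚ.≤ a l ℚ.+ + c ℚ./ suc l) → Cauchy a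
  cauchy-by a c h ε 0<ε = N , λ m n m≥ n≥ → go m n m≥ n≥
    where
    N = proj₁ (c/1+l<ε c ε 0<ε)
    open ℚ.+-*-Solver
    cancel : ∀ x y → (x ℚ.+ y) ℚ.- x ≡ y
    cancel = solve 2 (λ x y → (x :+ y) :- x := y) refl
    flip : ∀ x y → ℚ.- (x ℚ.- y) ≡ y ℚ.- x
    flip = solve 2 (λ x y → :- (x :- y) := y :- x) refl
    one : ∀ m n → N ℕ.≤ n → a m ℚ.- a n ℚ.< ε
    one m n n≥ = ℚ.≤-<-trans
      (subst (a m ℚ.- a n ℚ.≤_) (cancel (a n) _) (ℚ.+-monoˡ-≤ (ℚ.- a n) (h m n)))
      (proj₂ (c/1+l<ε c ε 0<ε) n n≥)
    go : ∀ m n → N ℕ.≤ m → N ℕ.≤ n → ℚ.∣ a m ℚ.- a n ∣ ℚ.< ε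
    go m n m≥ n≥ with ℚ.∣p∣≡p∨∣p∣≡-p (a m ℚ.- a n)
    ... | inj₁ eq = subst (ℚ._< ε) (sym eq) (one m n n≥)
    ... | inj₂ eq = subst (ℚ._< ε) (sym (trans eq (flip (a m) (a n)))) (one n m m≥)

  fraction-≤ : ∀ p K q L c l →
    p ℕ.* (suc L ℕ.* suc l) ℕ.≤ (q ℕ.* suc l ℕ.+ c ℕ.* suc L) ℕ.* suc K →
    + p ℚ./ suc K ℚ.≤ + q ℚ./ suc L ℚ.+ + c ℚ./ suc l
  fraction-≤ p K q L c l h = ℚ.toℚᵘ-cancel-≤ (ℚᵘ.≤-respˡ-≃
    (ℚᵘ.≃-sym {x = ℚ.toℚᵘ (+ p ℚ./ suc K)} (ℚ.toℚᵘ-fromℚᵘ (mkℚᵘ (+ p) K)))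
    (ℚᵘ.≤-respʳ-≃
      (ℚᵘ.≃-sym
        {x = ℚ.toℚᵘ (+ q ℚ./ suc L ℚ.+ + c ℚ./ suc l)}
        (ℚᵘ.≃-trans {j = ℚ.toℚᵘ (+ q ℚ./ suc L) ℚᵘ.+ ℚ.toℚᵘ (+ c ℚ./ suc l)}
          (ℚ.toℚᵘ-homo-+ (+ q ℚ./ suc L) (+ c ℚ./ suc l))
          (ℚᵘ.+-cong
            {x = ℚ.toℚᵘ (+ q ℚ./ suc L)} {y = mkℚᵘ (+ q) L}
            {u = ℚ.toℚᵘ (+ c ℚ./ suc l)} {v = mkℚᵘ (+ c) l}
            (ℚ.toℚᵘ-fromℚᵘ (mkℚᵘ (+ q) L)) (ℚ.toℚᵘ-fromℚᵘ (mkℚᵘ (+ c) l)))))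
      (ℚᵘ.*≤* (subst₂ ℤ._≤_ (ℤ.pos-* p _)
        (trans (ℤ.pos-* (q ℕ.* suc l ℕ.+ c ℕ.* suc L) (suc K))
          (cong (ℤ._* + suc K)
            (trans (ℤ.pos-+ (q ℕ.* suc l) _)
              (cong₂ ℤ._+_ (ℤ.pos-* q _) (ℤ.pos-* c _)))))
        (ℤ.+≤+ h)))))

  square-cancel-≤ : ∀ {a b} → a ℕ.* a ℕ.≤ b ℕ.* b → a ℕ.≤ b
  square-cancel-≤ h = ℕ.≮⇒≥ λ b<a →
    ℕ.<⇒≱ (ℕ.*-mono-< b<a b<a) h

-- √n is the limit of its rational approximations ⌊√(n k²)⌋ / k, k = 1, 2, …
√ : ℕ → ℝ
√ n = mkℝ (λ k → + r (suc k) ℚ./ suc k) (cauchy-by _ 1 λ k l →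
    fraction-≤ (r (suc k)) k (r (suc l)) l 1 l (bound (suc k) (suc l)))
  where
  r : ℕ → ℕ
  r k = ⌊√ n ℕ.* (k ℕ.* k) ⌋

  r-≤ : ∀ k l → r k ℕ.* l ℕ.≤ suc (r l) ℕ.* k
  r-≤ k l = square-cancel-≤ (begin
    (r k ℕ.* l) ℕ.* (r k ℕ.* l)             ≡⟨ eq₁ (r k) l ⟩
    (r k ℕ.* r k) ℕ.* (l ℕ.* l)             ≤⟨ ℕ.*-monoˡ-≤ (l ℕ.* l) (⌊√⌋-lower (n ℕ.* (k ℕ.* k))) ⟩
    n ℕ.* (k ℕ.* k) ℕ.* (l ℕ.* l)           ≡⟨ eq₂ n k l ⟩
    n ℕ.* (l ℕ.* l) ℕ.* (k ℕ.* k)           ≤⟨ ℕ.*-monoˡ-≤ (k ℕ.* k) (ℕ.<⇒≤ (⌊√⌋-upper (n ℕ.* (l ℕ.* l)))) ⟩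
    suc (r l) ℕ.* suc (r l) ℕ.* (k ℕ.* k)   ≡⟨ sym (eq₁ (suc (r l)) k) ⟩
    (suc (r l) ℕ.* k) ℕ.* (suc (r l) ℕ.* k) ∎)
    where
    open ℕ.≤-Reasoning
    open +-*-Solver
    eq₁ : ∀ a b → (a ℕ.* b) ℕ.* (a ℕ.* b) ≡ (a ℕ.* a) ℕ.* (b ℕ.* b)
    eq₁ = solve 2 (λ a b → (a :* b) :* (a :* b) := (a :* a) :* (b :* b)) refl
    eq₂ : ∀ a b c → a ℕ.* (b ℕ.* b) ℕ.* (c ℕ.* c) ≡ a ℕ.* (c ℕ.* c) ℕ.* (b ℕ.* b)
    eq₂ = solve 3 (λ a b c →
      a :* (b :* b) :* (c :* c) := a :* (c :* c) :* (b :* b)) refl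

  bound : ∀ k l → r k ℕ.* (l ℕ.* l) ℕ.≤ (r l ℕ.* l ℕ.+ 1 ℕ.* l) ℕ.* k
  bound k l = begin
    r k ℕ.* (l ℕ.* l)                ≡⟨ sym (ℕ.*-assoc (r k) l l) ⟩
    r k ℕ.* l ℕ.* l                  ≤⟨ ℕ.*-monoˡ-≤ l (r-≤ k l) ⟩
    suc (r l) ℕ.* k ℕ.* l            ≡⟨ eq (r l) k l ⟩
    (r l ℕ.* l ℕ.+ 1 ℕ.* l) ℕ.* k    ∎
    where
    open ℕ.≤-Reasoning
    open +-*-Solver
    eq : ∀ a k l → suc a ℕ.* k ℕ.* l ≡ (a ℕ.* l ℕ.+ 1 ℕ.* l) ℕ.* k
    eq = solve 3 (λ a k l →
      (con 1 :+ a) :* k :* l := (a :* l :+ con 1 :* l) :* k) refl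

-- π is the area of the unit disc. The a-th column of the N × N grid of
-- squares of side 1 / N over [0, 1]² has ⌊√(N² - a²)⌋ squares inside the
-- disc (a = 1, …, N), so the squares inside the disc in this quadrant
-- number quarterDisc N, and 4 · quarterDisc N / N² tends to the area.
column : ℕ → ℕ → ℕ
column N a = ⌊√ N ℕ.* N ℕ.∸ a ℕ.* a ⌋

quarterDisc : ℕ → ℕ
quarterDisc N = sum (applyUpTo (λ i → column N (suc i)) N)

private
  S : ℕ → (ℕ → ℕ) → ℕ
  S n f = sum (applyUpTo f n)

  S-mono : ∀ n {f g} → (∀ i → i ℕ.< n → f i ℕ.≤ g i) → S n f ℕ.≤ S n g
  S-mono zero h = ℕ.z≤n
  S-mono (suc n) h = ℕ.+-mono-≤ (h 0 (ℕ.s≤s ℕ.z≤n))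
    (S-mono n λ i i<n → h (suc i) (ℕ.s≤s i<n))

  S-cong : ∀ n {f g} → (∀ i → i ℕ.< n → f i ≡ g i) → S n f ≡ S n g
  S-cong zero h = refl
  S-cong (suc n) h = cong₂ ℕ._+_ (h 0 (ℕ.s≤s ℕ.z≤n))
    (S-cong n λ i i<n → h (suc i) (ℕ.s≤s i<n))

  S-const : ∀ n c → S n (λ _ → c) ≡ n ℕ.* c
  S-const zero c = refl
  S-const (suc n) c = cong (c ℕ.+_) (S-const n c)

  S-scale : ∀ n c f → S n (λ i → c ℕ.* f i) ≡ c ℕ.* S n f
  S-scale zero c f = sym (ℕ.*-zeroʳ c)
  S-scale (suc n) c f = trans (cong (c ℕ.* f 0 ℕ.+_) (S-scale n c (λ i → f (suc i))))
    (sym (ℕ.*-distribˡ-+ c (f 0) _))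

  S-split : ∀ m n f → S (m ℕ.+ n) f ≡ S m f ℕ.+ S n (λ i → f (m ℕ.+ i))
  S-split zero n f = refl
  S-split (suc m) n f = trans (cong (f 0 ℕ.+_) (S-split m n (λ i → f (suc i))))
    (sym (ℕ.+-assoc (f 0) _ _))

  S-suc : ∀ n f → S n (λ i → suc (f i)) ≡ n ℕ.+ S n f
  S-suc zero f = refl
  S-suc (suc n) f = cong suc (trans (cong (f 0 ℕ.+_) (S-suc n (λ i → f (suc i))))
    (eq (f 0) n _))
    where
    open +-*-Solver
    eq : ∀ a b c → a ℕ.+ (b ℕ.+ c) ≡ b ℕ.+ (a ℕ.+ c)
    eq = solve 3 (λ a b c → a :+ (b :+ c) := b :+ (a :+ c)) refl

  S-shift : ∀ n f → S n f ℕ.≤ f 0 ℕ.+ S n (λ i → f (suc i))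
  S-shift zero f = ℕ.z≤n
  S-shift (suc n) f = ℕ.+-monoʳ-≤ (f 0) (S-shift n (λ i → f (suc i)))

  S-blocks : ∀ N M f .{{_ : NonZero M}} → S (N ℕ.* M) (λ i → f (i ℕ./ M)) ≡ M ℕ.* S N f
  S-blocks zero M f = sym (ℕ.*-zeroʳ M)
  S-blocks (suc N) M f = begin
    S (M ℕ.+ N ℕ.* M) (λ i → f (i ℕ./ M))
      ≡⟨ S-split M (N ℕ.* M) _ ⟩
    S M (λ i → f (i ℕ./ M)) ℕ.+ S (N ℕ.* M) (λ i → f ((M ℕ.+ i) ℕ./ M))
      ≡⟨ cong₂ ℕ._+_
           (trans (S-cong M λ i i<M → cong f (ℕ.m<n⇒m/n≡0 i<M)) (S-const M (f 0)))
           (trans (S-cong (N ℕ.* M) λ i _ → cong f (next i))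
             (S-blocks N M (λ i → f (suc i)))) ⟩
    M ℕ.* f 0 ℕ.+ M ℕ.* S N (λ i → f (suc i))
      ≡⟨ sym (ℕ.*-distribˡ-+ M (f 0) _) ⟩
    M ℕ.* S (suc N) f ∎
    where
    open ≡-Reasoning
    next : ∀ i → (M ℕ.+ i) ℕ./ M ≡ suc (i ℕ./ M)
    next i = trans (ℕ.m/n≡1+[m∸n]/n (ℕ.m≤m+n M i))
      (cong (λ j → suc (j ℕ./ M)) (ℕ.m+n∸m≡n M i))

  column-≤ : ∀ N M k l → N ℕ.* l ℕ.≤ M ℕ.* k →
    M ℕ.* column N k ℕ.≤ N ℕ.* suc (column M l)
  column-≤ N M k l Nl≤Mk with column N k | ⌊√⌋-lower (N ℕ.* N ℕ.∸ k ℕ.* k)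
  ... | zero      | _   = subst (ℕ._≤ N ℕ.* suc (column M l)) (sym (ℕ.*-zeroʳ M)) ℕ.z≤n
  ... | b@(suc _) | b²≤ = ℕ.≮⇒≥ λ NH<Mb → ℕ.<⇒≱ (ℕ.*-mono-< NH<Mb NH<Mb)
    (ℕ.+-cancelʳ-≤ ((M ℕ.* k) ℕ.* (M ℕ.* k)) _ _ (begin
      (M ℕ.* b) ℕ.* (M ℕ.* b) ℕ.+ (M ℕ.* k) ℕ.* (M ℕ.* k)
        ≡⟨ eq M b k ⟩
      (M ℕ.* M) ℕ.* (b ℕ.* b ℕ.+ k ℕ.* k)
        ≤⟨ ℕ.*-monoʳ-≤ (M ℕ.* M) b²+k²≤N² ⟩
      (M ℕ.* M) ℕ.* (N ℕ.* N)
        ≡⟨ ℕ.*-comm (M ℕ.* M) _ ⟩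
      (N ℕ.* N) ℕ.* (M ℕ.* M)
        ≤⟨ ℕ.*-monoʳ-≤ (N ℕ.* N) M²≤H²+l² ⟩
      (N ℕ.* N) ℕ.* (H ℕ.* H ℕ.+ l ℕ.* l)
        ≡⟨ sym (eq N H l) ⟩
      (N ℕ.* H) ℕ.* (N ℕ.* H) ℕ.+ (N ℕ.* l) ℕ.* (N ℕ.* l)
        ≤⟨ ℕ.+-monoʳ-≤ ((N ℕ.* H) ℕ.* (N ℕ.* H)) (ℕ.*-mono-≤ Nl≤Mk Nl≤Mk) ⟩
      (N ℕ.* H) ℕ.* (N ℕ.* H) ℕ.+ (M ℕ.* k) ℕ.* (M ℕ.* k) ∎))
    where
    open ℕ.≤-Reasoning
    open +-*-Solver
    H = suc (column M l)
    eq : ∀ a b c → (a ℕ.* b) ℕ.* (a ℕ.* b) ℕ.+ (a ℕ.* c) ℕ.* (a ℕ.* c)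
       ≡ (a ℕ.* a) ℕ.* (b ℕ.* b ℕ.+ c ℕ.* c)
    eq = solve 3 (λ a b c → (a :* b) :* (a :* b) :+ (a :* c) :* (a :* c)
      := (a :* a) :* (b :* b :+ c :* c)) refl
    k²≤N² : k ℕ.* k ℕ.≤ N ℕ.* N
    k²≤N² = ℕ.<⇒≤ (ℕ.m∸n≢0⇒n<m λ z →
      contradiction (subst (b ℕ.* b ℕ.≤_) z b²≤) λ ())
    b²+k²≤N² : b ℕ.* b ℕ.+ k ℕ.* k ℕ.≤ N ℕ.* N
    b²+k²≤N² = subst (b ℕ.* b ℕ.+ k ℕ.* k ℕ.≤_) (ℕ.m∸n+n≡m k²≤N²)
      (ℕ.+-monoˡ-≤ (k ℕ.* k) b²≤)
    M²≤H²+l² : M ℕ.* M ℕ.≤ H ℕ.* H ℕ.+ l ℕ.* l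
    M²≤H²+l² = ℕ.≤-trans (ℕ.m≤n+m∸n (M ℕ.* M) (l ℕ.* l))
      (subst (ℕ._≤ H ℕ.* H ℕ.+ l ℕ.* l) (ℕ.+-comm _ (l ℕ.* l))
        (ℕ.+-monoˡ-≤ (l ℕ.* l) (ℕ.<⇒≤ (⌊√⌋-upper (M ℕ.* M ℕ.∸ l ℕ.* l)))))

  column-0 : ∀ M → column M 0 ℕ.≤ M
  column-0 M = square-cancel-≤ (⌊√⌋-lower (M ℕ.* M))

  quarterDisc-≤ : ∀ N M .{{_ : NonZero N}} .{{_ : NonZero M}} →
    quarterDisc N ℕ.* (M ℕ.* M) ℕ.≤ (quarterDisc M ℕ.+ 2 ℕ.* M) ℕ.* (N ℕ.* N)
  quarterDisc-≤ N M = begin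
    quarterDisc N ℕ.* (M ℕ.* M)
      ≡⟨ trans (ℕ.*-comm _ (M ℕ.* M)) (ℕ.*-assoc M M _) ⟩
    M ℕ.* (M ℕ.* quarterDisc N)
      ≡⟨ cong (M ℕ.*_) (sym (S-scale N M (λ i → column N (suc i)))) ⟩
    M ℕ.* S N (λ i → M ℕ.* column N (suc i))
      ≡⟨ sym (S-blocks N M (λ i → M ℕ.* column N (suc i))) ⟩
    S (N ℕ.* M) (λ i → M ℕ.* column N (suc (i ℕ./ M)))
      ≤⟨ S-mono (N ℕ.* M) (λ i _ → column-≤ N M (suc (i ℕ./ M)) (i ℕ./ N) (cells i)) ⟩
    S (N ℕ.* M) (λ i → N ℕ.* suc (column M (i ℕ./ N)))
      ≡⟨ cong (λ n → S n (λ i → N ℕ.* suc (column M (i ℕ./ N)))) (ℕ.*-comm N M) ⟩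
    S (M ℕ.* N) (λ i → N ℕ.* suc (column M (i ℕ./ N)))
      ≡⟨ S-blocks M N (λ i → N ℕ.* suc (column M i)) ⟩
    N ℕ.* S M (λ i → N ℕ.* suc (column M i))
      ≡⟨ cong (N ℕ.*_) (S-scale M N (λ i → suc (column M i))) ⟩
    N ℕ.* (N ℕ.* S M (λ i → suc (column M i)))
      ≡⟨ cong (λ s → N ℕ.* (N ℕ.* s)) (S-suc M (column M)) ⟩
    N ℕ.* (N ℕ.* (M ℕ.+ S M (column M)))
      ≤⟨ ℕ.*-monoʳ-≤ N (ℕ.*-monoʳ-≤ N (ℕ.+-monoʳ-≤ M
           (ℕ.≤-trans (S-shift M (column M)) (ℕ.+-monoˡ-≤ _ (column-0 M))))) ⟩
    N ℕ.* (N ℕ.* (M ℕ.+ (M ℕ.+ quarterDisc M)))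
      ≡⟨ eq N M (quarterDisc M) ⟩
    (quarterDisc M ℕ.+ 2 ℕ.* M) ℕ.* (N ℕ.* N) ∎
    where
    open ℕ.≤-Reasoning
    open +-*-Solver
    eq : ∀ n m q → n ℕ.* (n ℕ.* (m ℕ.+ (m ℕ.+ q))) ≡ (q ℕ.+ 2 ℕ.* m) ℕ.* (n ℕ.* n)
    eq = solve 3 (λ n m q → n :* (n :* (m :+ (m :+ q)))
      := (q :+ con 2 :* m) :* (n :* n)) refl
    cells : ∀ i → N ℕ.* (i ℕ./ N) ℕ.≤ M ℕ.* suc (i ℕ./ M)
    cells i = begin
      N ℕ.* (i ℕ./ N)              ≡⟨ ℕ.*-comm N _ ⟩
      i ℕ./ N ℕ.* N                ≤⟨ ℕ.m/n*n≤m i N ⟩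
      i                            ≡⟨ ℕ.m≡m%n+[m/n]*n i M ⟩
      i ℕ.% M ℕ.+ i ℕ./ M ℕ.* M    ≤⟨ ℕ.+-monoˡ-≤ _ (ℕ.<⇒≤ (ℕ.m%n<n i M)) ⟩
      suc (i ℕ./ M) ℕ.* M          ≡⟨ ℕ.*-comm (suc (i ℕ./ M)) M ⟩
      M ℕ.* suc (i ℕ./ M)          ∎

π : ℝ
π = mkℝ (λ k → + (4 ℕ.* quarterDisc (suc k)) ℚ./ (suc k ℕ.* suc k))
  (cauchy-by _ 8 λ k l →
    fraction-≤ (4 ℕ.* quarterDisc (suc k)) _ (4 ℕ.* quarterDisc (suc l)) _ 8 l
      (bound (suc k) (suc l)))
  where
  bound : ∀ N M .{{_ : NonZero N}} .{{_ : NonZero M}} →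
    4 ℕ.* quarterDisc N ℕ.* (M ℕ.* M ℕ.* M) ℕ.≤
    (4 ℕ.* quarterDisc M ℕ.* M ℕ.+ 8 ℕ.* (M ℕ.* M)) ℕ.* (N ℕ.* N)
  bound N M = begin
    4 ℕ.* quarterDisc N ℕ.* (M ℕ.* M ℕ.* M)
      ≡⟨ eq₁ (quarterDisc N) M ⟩
    4 ℕ.* M ℕ.* (quarterDisc N ℕ.* (M ℕ.* M))
      ≤⟨ ℕ.*-monoʳ-≤ (4 ℕ.* M) (quarterDisc-≤ N M) ⟩
    4 ℕ.* M ℕ.* ((quarterDisc M ℕ.+ 2 ℕ.* M) ℕ.* (N ℕ.* N))
      ≡⟨ eq₂ (quarterDisc M) M N ⟩
    (4 ℕ.* quarterDisc M ℕ.* M ℕ.+ 8 ℕ.* (M ℕ.* M)) ℕ.* (N ℕ.* N) ∎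
    where
    open ℕ.≤-Reasoning
    open +-*-Solver
    eq₁ : ∀ q m → 4 ℕ.* q ℕ.* (m ℕ.* m ℕ.* m) ≡ 4 ℕ.* m ℕ.* (q ℕ.* (m ℕ.* m))
    eq₁ = solve 2 (λ q m → con 4 :* q :* (m :* m :* m)
      := con 4 :* m :* (q :* (m :* m))) refl
    eq₂ : ∀ q m n → 4 ℕ.* m ℕ.* ((q ℕ.+ 2 ℕ.* m) ℕ.* (n ℕ.* n))
        ≡ (4 ℕ.* q ℕ.* m ℕ.+ 8 ℕ.* (m ℕ.* m)) ℕ.* (n ℕ.* n)
    eq₂ = solve 3 (λ q m n → con 4 :* m :* ((q :+ con 2 :* m) :* (n :* n))
      := (con 4 :* q :* m :+ con 8 :* (m :* m)) :* (n :* n)) refl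

-- Nearest integers, half-integers rounded up. (ℚ.round of the standard
-- library rounds half-integers away from zero instead.)
nint : ℚ → ℤ
nint x = ℚ.floor (x ℚ.+ ½)

-- The index j ranges over 0, …, n - 1 and stands for k = j + 1.
𝓡 : ℕ → ℕ
𝓡 n = length (filter (λ j → ¬? (+ 2 ℤ.∣? nint (+ n ℚ./ suc j))) (upTo n))

{-# OPTIONS --safe #-}
module Submission where

-- Rounding gives j < nint (n / k) exactly when (2j + 1) k ≤ 2n, and the parity
-- of c is the alternating sum of [j < c]. Summing over k ≤ n and exchanging
-- sums turns 𝓡 n + n into ∑ (-1)^j ⌊2n / (2j + 1)⌋; the terms j ≥ √(2n) affect
-- only O(√n) of the k, and removing the floors from the others costs O(√n).
-- It remains to see that the alternating sum of 1 / (2j + 1) is π / 4, with an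
-- error of at most the next term, for the π obtained by counting squares. The
-- points at the angles 2 arctan (i / N), i ≤ N, cut the quarter disc into
-- columns of rational coordinates; their area differs by telescoping terms from
-- ∑ (1 / N) / (1 + (i / N)²), which is compared with the increments of the
-- Taylor polynomial of arctan on each interval [i / N, (i + 1) / N].

import Data.Integer.Base as ℤ
import Data.Integer.Divisibility.Signed as ℤ
import Data.Integer.Properties as ℤ
open import Data.List.Base using (length; filter; applyUpTo)
open import Data.Nat.Base as ℕ using (ℕ; zero; suc; NonZero; z≤n; s≤s; z<s; _!)
import Data.Nat.Divisibility as ℕ
import Data.Nat.DivMod as ℕ
open import Data.Nat.ListAction using (sum)
import Data.Nat.Properties as ℕ
import Data.Nat.Tactic.RingSolver as ℕ-Solver
open import Data.Product.Base using (∃-syntax; _×_; _,_; proj₁; proj₂)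
import Data.Rational.Base as ℚ
import Data.Rational.Properties as ℚ
import Data.Rational.Unnormalised.Base as ℚᵘ
import Data.Rational.Unnormalised.Properties as ℚᵘ
open import Data.Sum.Base using (inj₁; inj₂)
open import Relation.Binary.PropositionalEquality hiding (J)
open import Relation.Nullary using (Dec; yes; no; ¬_; ¬?; contradiction)
open import Relation.Nullary.Decidable.Core using (dec⇒maybe)
open import Tactic.RingSolver using (solve-∀)
open import Tactic.RingSolver.Core.AlmostCommutativeRing
  using (AlmostCommutativeRing; fromCommutativeRing)

-- No integral is available: `π` is known only through counts of squares, so `arctan` enters as a
-- truncated polynomial and every estimate is an inequality between rationals. The angle 2 arctan t
-- is used because the sector it spans has area arctan t while its end point is rational in t. When
-- the radius is divisible by all N² + i², these points are lattice points and the columns through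
-- them have exact integer heights, so that no square root is left; other radii are reached only
-- through the Cauchy property of `π`. Each local error is bounded by the increment of a monotone
-- function, so that refining the subdivision does not accumulate errors. For fixed J, what survives
-- as N grows is 1 / (2J + 1), up to a constant factor. In the count it is multiplied by 2n, and
-- with J near √(2n) the product has the same order √n as the other losses.

module Estimates where
  open import Data.Rational.Base hiding (NonZero)
  open import Defs using (nint; 𝓡; seq; cauchy; π; √; ⌊√_⌋; ⌊√⌋-lower; ⌊√⌋-upper; column; quarterDisc)

  -- Rational numbers

  ring : AlmostCommutativeRing _ _
  ring = fromCommutativeRing ℚ.+-*-commutativeRing λ p → dec⇒maybe (0ℚ ℚ.≟ p)

  0≤1 : 0ℚ ≤ 1ℚ
  0≤1 = ℚ.nonNegative⁻¹ 1ℚ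

  0≤p+q : ∀ {p q} → 0ℚ ≤ p → 0ℚ ≤ q → 0ℚ ≤ p + q
  0≤p+q {p} {q} hp hq = ℚ.+-mono-≤ hp hq

  0≤p*q : ∀ {p q} → 0ℚ ≤ p → 0ℚ ≤ q → 0ℚ ≤ p * q
  0≤p*q {p} {q} hp hq = ℚ.nonNegative⁻¹ (p * q)
    {{ℚ.nonNeg*nonNeg⇒nonNeg p {{nonNegative hp}} q {{nonNegative hq}}}}

  p≤q⇒0≤q-p : ∀ {p q} → p ≤ q → 0ℚ ≤ q - p
  p≤q⇒0≤q-p {p} {q} h = subst (_≤ q - p) (ℚ.+-inverseʳ p) (ℚ.+-monoˡ-≤ (- p) h)

  -- Inequalities are proved by exhibiting the difference as a sum of products
  -- of non-negative terms, so that what remains is a ring identity.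
  ≤-difference : ∀ {p q r} → 0ℚ ≤ r → p + r ≡ q → p ≤ q
  ≤-difference {p} {q} {r} h eq = subst₂ _≤_ (ℚ.+-identityʳ p) eq (ℚ.+-monoʳ-≤ p h)

  *-distribˡ-- : ∀ p q r → p * (q - r) ≡ p * q - p * r
  *-distribˡ-- = solve-∀ ring

  *-monoˡ-≤ : ∀ {p q r} → 0ℚ ≤ r → p ≤ q → r * p ≤ r * q
  *-monoˡ-≤ {r = r} h = ℚ.*-monoˡ-≤-nonNeg r {{nonNegative h}}

  *-mono-≤ : ∀ {p q r s} → 0ℚ ≤ p → 0ℚ ≤ r → p ≤ q → r ≤ s → p * r ≤ q * s
  *-mono-≤ {p} {q} {r} {s} 0≤p 0≤r h k = ℚ.≤-trans (*-monoˡ-≤ 0≤p k)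
    (ℚ.*-monoʳ-≤-nonNeg s {{nonNegative (ℚ.≤-trans 0≤r k)}} h)

  ι : ℕ → ℚ
  ι n = ℤ.+ n / 1

  toℚᵘ-/ : ∀ a d → ℚᵘ._≃_ (toℚᵘ (ℤ.+ a / suc d)) (ℚᵘ.mkℚᵘ (ℤ.+ a) d)
  toℚᵘ-/ a d = ℚ.toℚᵘ-fromℚᵘ (ℚᵘ.mkℚᵘ (ℤ.+ a) d)

  ι-+ : ∀ m n → ι (m ℕ.+ n) ≡ ι m + ι n
  ι-+ m n = ℚ.toℚᵘ-injective (begin
    toℚᵘ (ι (m ℕ.+ n))        ≈⟨ toℚᵘ-/ (m ℕ.+ n) 0 ⟩
    ℚᵘ.mkℚᵘ (ℤ.+ (m ℕ.+ n)) 0   ≈⟨ ℚᵘ.*≡* (cong (ℤ._* ℤ.+ 1) (trans (ℤ.pos-+ m n) (sym (cong₂ ℤ._+_ (ℤ.*-identityʳ (ℤ.+ m)) (ℤ.*-identityʳ (ℤ.+ n)))))) ⟩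
    ℚᵘ.mkℚᵘ (ℤ.+ m) 0 ℚᵘ.+ ℚᵘ.mkℚᵘ (ℤ.+ n) 0  ≈⟨ ℚᵘ.+-cong {x = toℚᵘ (ι m)} {u = toℚᵘ (ι n)} (toℚᵘ-/ m 0) (toℚᵘ-/ n 0) ⟨
    toℚᵘ (ι m) ℚᵘ.+ toℚᵘ (ι n) ≈⟨ ℚ.toℚᵘ-homo-+ (ι m) (ι n) ⟨
    toℚᵘ (ι m + ι n) ∎)
    where open ℚᵘ.≃-Reasoning

  /-*-cancel : ∀ a d .{{_ : NonZero d}} → (ℤ.+ a / d) * ι d ≡ ι a
  /-*-cancel a d@(suc d-1) = ℚ.toℚᵘ-injective (begin
    toℚᵘ ((ℤ.+ a / d) * ι d)              ≈⟨ ℚ.toℚᵘ-homo-* (ℤ.+ a / d) (ι d) ⟩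
    toℚᵘ (ℤ.+ a / d) ℚᵘ.* toℚᵘ (ι d)      ≈⟨ ℚᵘ.*-cong {x = toℚᵘ (ℤ.+ a / d)} {u = toℚᵘ (ι d)} (toℚᵘ-/ a d-1) (toℚᵘ-/ d 0) ⟩
    ℚᵘ.mkℚᵘ (ℤ.+ a) d-1 ℚᵘ.* ℚᵘ.mkℚᵘ (ℤ.+ d) 0 ≈⟨ ℚᵘ.*≡* (trans (ℤ.*-identityʳ _) (cong (λ e → ℤ.+ a ℤ.* ℤ.+ e) (sym (ℕ.*-identityʳ d)))) ⟩
    ℚᵘ.mkℚᵘ (ℤ.+ a) 0                     ≈⟨ toℚᵘ-/ a 0 ⟨
    toℚᵘ (ι a) ∎)
    where open ℚᵘ.≃-Reasoning

  0≤/ : ∀ a d .{{_ : NonZero d}} → 0ℚ ≤ ℤ.+ a / d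
  0≤/ a d = ℚ.nonNegative⁻¹ (ℤ.+ a / d) {{ℚ.normalize-nonNeg a d}}

  0≤ι : ∀ n → 0ℚ ≤ ι n
  0≤ι n = 0≤/ n 1

  ι-pos : ∀ n .{{_ : NonZero n}} → Positive (ι n)
  ι-pos (suc n) = ℚ.normalize-pos (suc n) 1

  ι-mono-≤ : ∀ {m n} → m ℕ.≤ n → ι m ≤ ι n
  ι-mono-≤ {m} {n} m≤n = ≤-difference (0≤ι (n ℕ.∸ m))
    (trans (sym (ι-+ m (n ℕ.∸ m))) (cong ι (ℕ.m+[n∸m]≡n m≤n)))

  ι-suc : ∀ n → ι (suc n) ≡ 1ℚ + ι n
  ι-suc = ι-+ 1

  ι-* : ∀ m n → ι (m ℕ.* n) ≡ ι m * ι n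
  ι-* zero    n = sym (ℚ.*-zeroˡ (ι n))
  ι-* (suc m) n = trans (ι-+ n (m ℕ.* n)) (trans (cong (ι n +_) (ι-* m n))
    (trans (lemma (ι m) (ι n)) (cong (_* ι n) (sym (ι-suc m)))))
    where
    lemma : ∀ a b → b + a * b ≡ (1ℚ + a) * b
    lemma = solve-∀ ring

  1/suc : ℕ → ℚ
  1/suc n = ℤ.+ 1 / suc n

  1/suc-inverse : ∀ n → 1/suc n * ι (suc n) ≡ 1ℚ
  1/suc-inverse n = /-*-cancel 1 (suc n)

  -- Two one-sided bounds in place of an absolute value: errors then add up without case
  -- distinctions, and absolute values appear only where the definitions of `Cauchy`, `_∈O_` and
  -- `_⟶_` demand them.
  record _≈_±_ (p q e : ℚ) : Set where
    constructor within
    field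
      upper : p ≤ q + e
      lower : q ≤ p + e

  infix 4 _≈_±_

  ≈-refl : ∀ {p q} → p ≡ q → p ≈ q ± 0ℚ
  ≈-refl {p} refl = within (ℚ.≤-reflexive (sym (ℚ.+-identityʳ p))) (ℚ.≤-reflexive (sym (ℚ.+-identityʳ p)))

  ≈-sym : ∀ {p q e} → p ≈ q ± e → q ≈ p ± e
  ≈-sym (within h k) = within k h

  ≈-weaken : ∀ {p q e f} → e ≤ f → p ≈ q ± e → p ≈ q ± f
  ≈-weaken {p} {q} e≤f (within h k) =
    within (ℚ.≤-trans h (ℚ.+-monoʳ-≤ q e≤f)) (ℚ.≤-trans k (ℚ.+-monoʳ-≤ p e≤f))

  ≈-trans : ∀ {p q r e f} → p ≈ q ± e → q ≈ r ± f → p ≈ r ± (e + f)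
  ≈-trans {p} {q} {r} {e} {f} (within h k) (within h′ k′) = within
    (ℚ.≤-trans h (ℚ.≤-trans (ℚ.+-monoˡ-≤ e h′) (ℚ.≤-reflexive (lemma r f e))))
    (ℚ.≤-trans k′ (ℚ.≤-trans (ℚ.+-monoˡ-≤ f k) (ℚ.≤-reflexive (ℚ.+-assoc p e f))))
    where
    lemma : ∀ r f e → r + f + e ≡ r + (e + f)
    lemma = solve-∀ ring

  ≈-+ : ∀ {p q r s e f} → p ≈ q ± e → r ≈ s ± f → p + r ≈ q + s ± (e + f)
  ≈-+ {p} {q} {r} {s} {e} {f} (within h k) (within h′ k′) = within
    (ℚ.≤-trans (ℚ.+-mono-≤ h h′) (ℚ.≤-reflexive (lemma q e s f)))
    (ℚ.≤-trans (ℚ.+-mono-≤ k k′) (ℚ.≤-reflexive (lemma p e r f)))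
    where
    lemma : ∀ q e s f → (q + e) + (s + f) ≡ (q + s) + (e + f)
    lemma = solve-∀ ring

  ≈-neg : ∀ {p q e} → p ≈ q ± e → - p ≈ - q ± e
  ≈-neg {p} {q} {e} (within h k) = within
    (≤-difference (p≤q⇒0≤q-p k) (lemma p q e)) (≤-difference (p≤q⇒0≤q-p h) (lemma q p e))
    where
    lemma : ∀ p q e → - p + (p + e - q) ≡ - q + e
    lemma = solve-∀ ring

  ≈-- : ∀ {p q r s e f} → p ≈ q ± e → r ≈ s ± f → p - r ≈ q - s ± (e + f)
  ≈-- h k = ≈-+ h (≈-neg k)

  ≈-* : ∀ {p q e} c → 0ℚ ≤ c → p ≈ q ± e → c * p ≈ c * q ± c * e
  ≈-* {p} {q} {e} c 0≤c (within h k) = within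
    (ℚ.≤-trans (*-monoˡ-≤ 0≤c h) (ℚ.≤-reflexive (ℚ.*-distribˡ-+ c q e)))
    (ℚ.≤-trans (*-monoˡ-≤ 0≤c k) (ℚ.≤-reflexive (ℚ.*-distribˡ-+ c p e)))

  ≈⇒∣-∣≤ : ∀ {p q e} → p ≈ q ± e → ∣ p - q ∣ ≤ e
  ≈⇒∣-∣≤ {p} {q} {e} (within h k) with ℚ.∣p∣≡p∨∣p∣≡-p (p - q)
  ... | inj₁ eq = subst (_≤ e) (sym eq) (≤-difference (p≤q⇒0≤q-p h) (lemma p q e))
    where
    lemma : ∀ p q e → p - q + (q + e - p) ≡ e
    lemma = solve-∀ ring
  ... | inj₂ eq = subst (_≤ e) (sym eq) (≤-difference (p≤q⇒0≤q-p k) (lemma p q e))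
    where
    lemma : ∀ p q e → - (p - q) + (p + e - q) ≡ e
    lemma = solve-∀ ring

  p≤∣p∣ : ∀ p → p ≤ ∣ p ∣
  p≤∣p∣ p with ℚ.≤-total 0ℚ p
  ... | inj₁ 0≤p = ℚ.≤-reflexive (sym (ℚ.0≤p⇒∣p∣≡p 0≤p))
  ... | inj₂ p≤0 = ℚ.≤-trans p≤0 (ℚ.0≤∣p∣ p)

  ∣-∣≤⇒≈ : ∀ {p q e} → ∣ p - q ∣ ≤ e → p ≈ q ± e
  ∣-∣≤⇒≈ {p} {q} {e} h = within
    (≤-difference (p≤q⇒0≤q-p (ℚ.≤-trans (p≤∣p∣ (p - q)) h)) (lemma p q e))
    (≤-difference (p≤q⇒0≤q-p (ℚ.≤-trans
      (subst (- (p - q) ≤_) (ℚ.∣-p∣≡∣p∣ (p - q)) (p≤∣p∣ (- (p - q)))) h)) (lemma′ p q e))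
    where
    lemma : ∀ p q e → p + (e - (p - q)) ≡ q + e
    lemma = solve-∀ ring
    lemma′ : ∀ p q e → q + (e - (- (p - q))) ≡ p + e
    lemma′ = solve-∀ ring

  -- `B` is a potential for the errors: its increments bound the single steps, so the total does not
  -- depend on their number.
  ≈-telescope : ∀ (f B : ℕ → ℚ) N → (∀ i → i ℕ.< N → f (suc i) ≈ f i ± (B (suc i) - B i)) →
    f N ≈ f 0 ± (B N - B 0)
  ≈-telescope f B zero    h = ≈-weaken (ℚ.≤-reflexive (sym (ℚ.+-inverseʳ (B 0)))) (≈-refl refl)
  ≈-telescope f B (suc N) h = subst (f (suc N) ≈ f 0 ±_) (lemma (B (suc N)) (B N) (B 0))
    (≈-trans (h N ℕ.≤-refl) (≈-telescope f B N λ i i<N → h i (ℕ.m<n⇒m<1+n i<N)))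
    where
    lemma : ∀ a b c → a - b + (b - c) ≡ a - c
    lemma = solve-∀ ring

  -- Finite sums and alternating sums

  ∑ : ℕ → (ℕ → ℚ) → ℚ
  ∑ zero    f = 0ℚ
  ∑ (suc n) f = f 0 + ∑ n λ i → f (suc i)

  alt : ℕ → (ℕ → ℚ) → ℚ
  alt zero    f = 0ℚ
  alt (suc n) f = f 0 - alt n λ i → f (suc i)

  ∑-cong : ∀ n {f g} → (∀ i → f i ≡ g i) → ∑ n f ≡ ∑ n g
  ∑-cong zero    h = refl
  ∑-cong (suc n) h = cong₂ _+_ (h 0) (∑-cong n λ i → h (suc i))

  ∑-mono-≤ : ∀ n {f g} → (∀ i → f i ≤ g i) → ∑ n f ≤ ∑ n g
  ∑-mono-≤ zero    h = ℚ.≤-refl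
  ∑-mono-≤ (suc n) h = ℚ.+-mono-≤ (h 0) (∑-mono-≤ n λ i → h (suc i))

  ∑-- : ∀ n f g → ∑ n (λ i → f i - g i) ≡ ∑ n f - ∑ n g
  ∑-- zero    f g = refl
  ∑-- (suc n) f g = trans (cong (f 0 - g 0 +_) (∑-- n _ _)) (lemma (f 0) (g 0) _ _)
    where
    lemma : ∀ a b c d → a - b + (c - d) ≡ a + c - (b + d)
    lemma = solve-∀ ring

  ∑-0 : ∀ n → ∑ n (λ _ → 0ℚ) ≡ 0ℚ
  ∑-0 zero    = refl
  ∑-0 (suc n) = trans (ℚ.+-identityˡ _) (∑-0 n)

  ∑-* : ∀ n c f → ∑ n (λ i → c * f i) ≡ c * ∑ n f
  ∑-* zero    c f = sym (ℚ.*-zeroʳ c)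
  ∑-* (suc n) c f = trans (cong (c * f 0 +_) (∑-* n c _)) (sym (ℚ.*-distribˡ-+ c _ _))

  ∑-1 : ∀ n → ∑ n (λ _ → 1ℚ) ≡ ι n
  ∑-1 zero    = refl
  ∑-1 (suc n) = trans (cong (1ℚ +_) (∑-1 n)) (sym (ι-suc n))

  ∑-≈ : ∀ n {f g e} → (∀ i → f i ≈ g i ± e i) → ∑ n f ≈ ∑ n g ± ∑ n e
  ∑-≈ zero    h = ≈-refl refl
  ∑-≈ (suc n) h = ≈-+ (h 0) (∑-≈ n λ i → h (suc i))

  alt-cong : ∀ n {f g} → (∀ i → f i ≡ g i) → alt n f ≡ alt n g
  alt-cong zero    h = refl
  alt-cong (suc n) h = cong₂ _-_ (h 0) (alt-cong n λ i → h (suc i))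

  alt-* : ∀ n c f → alt n (λ i → c * f i) ≡ c * alt n f
  alt-* zero    c f = sym (ℚ.*-zeroʳ c)
  alt-* (suc n) c f = trans (cong (λ z → c * f 0 - z) (alt-* n c _)) (sym (*-distribˡ-- c (f 0) _))

  alt-- : ∀ n f g → alt n (λ i → f i - g i) ≡ alt n f - alt n g
  alt-- zero    f g = refl
  alt-- (suc n) f g = trans (cong (λ z → f 0 - g 0 - z) (alt-- n _ _)) (lemma (f 0) (g 0) _ _)
    where
    lemma : ∀ a b c d → a - b - (c - d) ≡ a - c - (b - d)
    lemma = solve-∀ ring

  alt-≈ : ∀ n {f g e} → (∀ i → f i ≈ g i ± e i) → alt n f ≈ alt n g ± ∑ n e
  alt-≈ zero    h = ≈-refl refl
  alt-≈ (suc n) h = ≈-- (h 0) (alt-≈ n λ i → h (suc i))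

  ∑-alt-swap : ∀ m n (F : ℕ → ℕ → ℚ) →
    ∑ m (λ i → alt n λ j → F i j) ≡ alt n (λ j → ∑ m λ i → F i j)
  ∑-alt-swap m zero    F = ∑-0 m
  ∑-alt-swap m (suc n) F = trans (∑-- m (λ i → F i 0) _)
    (cong (λ z → ∑ m (λ i → F i 0) - z) (∑-alt-swap m n λ i j → F i (suc j)))

  -- The counting function and the Leibniz sum

  -- The indicator of `i < c` with rational values, by recursion on both arguments so that `∑` and
  -- `alt` of it unfold in step.
  below : ℕ → ℕ → ℚ
  below zero    i       = 0ℚ
  below (suc c) zero    = 1ℚ
  below (suc c) (suc i) = below c i

  0≤below : ∀ c i → 0ℚ ≤ below c i
  0≤below zero    i       = ℚ.≤-refl
  0≤below (suc c) zero    = 0≤1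
  0≤below (suc c) (suc i) = 0≤below c i

  below≤1 : ∀ c i → below c i ≤ 1ℚ
  below≤1 zero    i       = 0≤1
  below≤1 (suc c) zero    = ℚ.≤-refl
  below≤1 (suc c) (suc i) = below≤1 c i

  i<c⇒below≡1 : ∀ {c i} → i ℕ.< c → below c i ≡ 1ℚ
  i<c⇒below≡1 {suc c} {zero}  i<c       = refl
  i<c⇒below≡1 {suc c} {suc i} (s≤s i<c) = i<c⇒below≡1 i<c

  i≮c⇒below≡0 : ∀ {c i} → ¬ i ℕ.< c → below c i ≡ 0ℚ
  i≮c⇒below≡0 {zero}          i≮c = refl
  i≮c⇒below≡0 {suc c} {zero}  i≮c = contradiction z<s i≮c
  i≮c⇒below≡0 {suc c} {suc i} i≮c = i≮c⇒below≡0 λ i<c → i≮c (s≤s i<c)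

  below-mono : ∀ c i d j → (i ℕ.< c → j ℕ.< d) → below c i ≤ below d j
  below-mono c i d j h with i ℕ.<? c
  ... | yes i<c = ℚ.≤-trans (below≤1 c i) (ℚ.≤-reflexive (sym (i<c⇒below≡1 (h i<c))))
  ... | no  i≮c = ℚ.≤-trans (ℚ.≤-reflexive (i≮c⇒below≡0 i≮c)) (0≤below d j)

  ∑-below : ∀ n c → ∑ n (below c) ≡ ι (n ℕ.⊓ c)
  ∑-below zero    c       = refl
  ∑-below (suc n) zero    = trans (ℚ.+-identityˡ _) (∑-0 n)
  ∑-below (suc n) (suc c) = trans (cong (1ℚ +_) (∑-below n c)) (sym (ι-suc (n ℕ.⊓ c)))

  parity : ℕ → ℚ
  parity zero    = 0ℚ
  parity (suc c) = 1ℚ - parity c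

  parity-bounds : ∀ c → 0ℚ ≤ parity c × parity c ≤ 1ℚ
  parity-bounds zero    = ℚ.≤-refl , 0≤1
  parity-bounds (suc c) with (h , k) ← parity-bounds c =
    p≤q⇒0≤q-p k , ≤-difference h (lemma (parity c))
    where
    lemma : ∀ p → 1ℚ - p + p ≡ 1ℚ
    lemma = solve-∀ ring

  alt-0 : ∀ n → alt n (λ _ → 0ℚ) ≡ 0ℚ
  alt-0 zero    = refl
  alt-0 (suc n) = cong (λ z → 0ℚ - z) (alt-0 n)

  -- With n ≥ c no term is lost and the error `below c n` vanishes; otherwise the error is 1 and
  -- both sides lie between 0 and 1.
  parity-≈-alt : ∀ c n → parity c ≈ alt n (below c) ± below c n
  parity-≈-alt zero    n       = ≈-refl (sym (alt-0 n))
  parity-≈-alt (suc c) zero    = let (h , k) = parity-bounds (suc c) in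
    within k (ℚ.≤-trans h (≤-difference 0≤1 refl))
  parity-≈-alt (suc c) (suc n) = subst (parity (suc c) ≈ alt (suc n) (below (suc c)) ±_)
    (ℚ.+-identityˡ (below c n)) (≈-- (≈-refl {1ℚ} refl) (parity-≈-alt c n))

  2∣⇒parity≡0 : ∀ c → 2 ℕ.∣ c → parity c ≡ 0ℚ
  2∤⇒parity≡1 : ∀ c → ¬ 2 ℕ.∣ c → parity c ≡ 1ℚ

  2∣⇒parity≡0 zero          h = refl
  2∣⇒parity≡0 (suc zero)    h = contradiction (ℕ.∣⇒≤ h) λ { (s≤s ()) }
  2∣⇒parity≡0 (suc (suc c)) h =
    cong (λ z → 1ℚ - (1ℚ - z)) (2∣⇒parity≡0 c (ℕ.∣m+n∣m⇒∣n h ℕ.∣-refl))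

  2∤⇒parity≡1 zero          h = contradiction (2 ℕ.∣0) h
  2∤⇒parity≡1 (suc zero)    h = refl
  2∤⇒parity≡1 (suc (suc c)) h =
    cong (λ z → 1ℚ - (1ℚ - z)) (2∤⇒parity≡1 c λ k → h (ℕ.∣m∣n⇒∣m+n ℕ.∣-refl k))

  length-filter-applyUpTo : ∀ {P : ℕ → Set} (P? : ∀ i → Dec (P i)) (w : ℕ → ℚ) →
    (∀ i → P i → w i ≡ 1ℚ) → (∀ i → ¬ P i → w i ≡ 0ℚ) →
    ∀ f n → ι (length (filter P? (applyUpTo f n))) ≡ ∑ n (λ i → w (f i))
  length-filter-applyUpTo P? w h k f zero    = refl
  length-filter-applyUpTo P? w h k f (suc n) with P? (f 0)
  ... | yes p = trans (ι-suc (length (filter P? (applyUpTo (λ i → f (suc i)) n))))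
    (cong₂ _+_ (sym (h (f 0) p)) (length-filter-applyUpTo P? w h k (λ i → f (suc i)) n))
  ... | no ¬p = trans (length-filter-applyUpTo P? w h k (λ i → f (suc i)) n)
    (trans (sym (ℚ.+-identityˡ rest)) (cong (_+ rest) (sym (k (f 0) ¬p))))
    where rest = ∑ n (λ i → w (f (suc i)))

  -- The reduced denominator of p need not be d, so only the cross product with a / d is known; both
  -- natural quotients are compared after expansion to the common denominator. A negative numerator
  -- contradicts the cross product.
  floor-≡ : ∀ p a d .{{_ : NonZero d}} → p * ι d ≡ ι a → floor p ≡ ℤ.+ (a ℕ./ d)
  floor-≡ p@(mkℚ num den-1 _) a d@(suc d-1) eq = lemma num num*d≡a*den
    where
    den = suc den-1
    p*d≃a : ℚᵘ._≃_ (ℚᵘ.mkℚᵘ num den-1 ℚᵘ.* ℚᵘ.mkℚᵘ (ℤ.+ d) 0) (ℚᵘ.mkℚᵘ (ℤ.+ a) 0)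
    p*d≃a = begin
      ℚᵘ.mkℚᵘ num den-1 ℚᵘ.* ℚᵘ.mkℚᵘ (ℤ.+ d) 0 ≈⟨ ℚᵘ.*-congˡ {toℚᵘ p} (toℚᵘ-/ d 0) ⟨
      toℚᵘ p ℚᵘ.* toℚᵘ (ι d)                   ≈⟨ ℚ.toℚᵘ-homo-* p (ι d) ⟨
      toℚᵘ (p * ι d)                           ≡⟨ cong toℚᵘ eq ⟩
      toℚᵘ (ι a)                               ≈⟨ toℚᵘ-/ a 0 ⟩
      ℚᵘ.mkℚᵘ (ℤ.+ a) 0 ∎
      where open ℚᵘ.≃-Reasoning
    num*d≡a*den : num ℤ.* ℤ.+ d ≡ ℤ.+ (a ℕ.* den)
    num*d≡a*den with ℚᵘ.*≡* e ← p*d≃a = trans (sym (ℤ.*-identityʳ _)) (trans e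
      (trans (cong (λ m → ℤ.+ a ℤ.* ℤ.+ m) (ℕ.*-identityʳ den)) (sym (ℤ.pos-* a den))))
    lemma : ∀ i → i ℤ.* ℤ.+ d ≡ ℤ.+ (a ℕ.* den) → i ℤ./ ℤ.+ den ≡ ℤ.+ (a ℕ./ d)
    lemma (ℤ.+ b) e = trans (ℤ.*-identityˡ _) (cong ℤ.+_ (begin
      b ℕ./ den                   ≡⟨ ℕ.m*n/o*n≡m/o b d den ⟨
      b ℕ.* d ℕ./ (den ℕ.* d)     ≡⟨ ℕ./-congˡ (ℤ.+-injective (trans (ℤ.pos-* b d) e)) ⟩
      a ℕ.* den ℕ./ (den ℕ.* d)   ≡⟨ ℕ./-congʳ {m = a ℕ.* den} (ℕ.*-comm den d) ⟩
      a ℕ.* den ℕ./ (d ℕ.* den)   ≡⟨ ℕ.m*n/o*n≡m/o a den d ⟩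
      a ℕ./ d ∎))
      where open ≡-Reasoning
    lemma ℤ.-[1+ b ] ()

  -- The floor of n / k + 1/2 over the common denominator 2k, where k = i + 1.
  nearest : ℕ → ℕ → ℕ
  nearest n i = (2 ℕ.* n ℕ.+ suc i) ℕ./ (2 ℕ.* suc i)

  nint-≡ : ∀ n i → nint (ℤ.+ n / suc i) ≡ ℤ.+ nearest n i
  nint-≡ n i = floor-≡ (q + ½) (2 ℕ.* n ℕ.+ suc i) (2 ℕ.* suc i) (begin
    (q + ½) * ι (2 ℕ.* suc i)               ≡⟨ cong ((q + ½) *_) (ι-* 2 (suc i)) ⟩
    (q + ½) * (ι 2 * ι (suc i))             ≡⟨ lemma q ½ (ι 2) (ι (suc i)) ⟩
    ι 2 * (q * ι (suc i)) + (½ * ι 2) * ι (suc i) ≡⟨ cong₂ (λ x y → ι 2 * x + y) (/-*-cancel n (suc i)) (ℚ.*-identityˡ _) ⟩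
    ι 2 * ι n + ι (suc i)                   ≡⟨ cong (_+ ι (suc i)) (ι-* 2 n) ⟨
    ι (2 ℕ.* n) + ι (suc i)                 ≡⟨ ι-+ (2 ℕ.* n) (suc i) ⟨
    ι (2 ℕ.* n ℕ.+ suc i) ∎)
    where
    open ≡-Reasoning
    q = ℤ.+ n / suc i
    lemma : ∀ q h t k → (q + h) * (t * k) ≡ t * (q * k) + (h * t) * k
    lemma = solve-∀ ring

  𝓡≡∑parity : ∀ n → ι (𝓡 n) ≡ ∑ n (λ i → parity (nearest n i))
  𝓡≡∑parity n = length-filter-applyUpTo
    (λ j → ¬? (ℤ.+ 2 ℤ.∣? nint (ℤ.+ n / suc j))) (λ i → parity (nearest n i))
    (λ i odd → 2∤⇒parity≡1 _ λ even →
      odd (ℤ.∣ᵤ⇒∣ (subst (λ z → 2 ℕ.∣ ℤ.∣ z ∣) (sym (nint-≡ n i)) even)))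
    (λ i ¬odd → 2∣⇒parity≡0 _ (even i ¬odd))
    (λ i → i) n
    where
    even : ∀ i → ¬ ¬ ℤ.+ 2 ℤ.∣ nint (ℤ.+ n / suc i) → 2 ℕ.∣ nearest n i
    even i ¬odd with 2 ℕ.∣? nearest n i
    ... | yes h = h
    ... | no  h = contradiction
      (λ k → h (subst (λ z → 2 ℕ.∣ ℤ.∣ z ∣) (nint-≡ n i) (ℤ.∣⇒∣ᵤ k))) ¬odd

  m≤a/d⇒m*d≤a : ∀ {m a} d .{{_ : NonZero d}} → m ℕ.≤ a ℕ./ d → m ℕ.* d ℕ.≤ a
  m≤a/d⇒m*d≤a {m} {a} d h = ℕ.≤-trans (ℕ.*-monoˡ-≤ d h) (ℕ.m/n*n≤m a d)

  m*d≤a⇒m≤a/d : ∀ {m a} d .{{_ : NonZero d}} → m ℕ.* d ℕ.≤ a → m ℕ.≤ a ℕ./ d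
  m*d≤a⇒m≤a/d {m} {a} d h = subst (ℕ._≤ a ℕ./ d) (ℕ.m*n/n≡m m d) (ℕ./-monoˡ-≤ d h)

  private
    rearrange : ∀ i j → suc j ℕ.* (2 ℕ.* suc i) ≡ suc i ℕ.* suc (2 ℕ.* j) ℕ.+ suc i
    rearrange = ℕ-Solver.solve-∀

  -- With k = i + 1, the condition j + 1 ≤ (2n + k) / 2k reads k (2j + 1) + k ≤ 2n + k, and the k
  -- that comes from rounding cancels.
  <nearest⇒ : ∀ n i j → j ℕ.< nearest n i → suc i ℕ.* suc (2 ℕ.* j) ℕ.≤ 2 ℕ.* n
  <nearest⇒ n i j h = ℕ.+-cancelʳ-≤ (suc i) _ _
    (subst (ℕ._≤ 2 ℕ.* n ℕ.+ suc i) (rearrange i j) (m≤a/d⇒m*d≤a (2 ℕ.* suc i) h))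

  ⇒<nearest : ∀ n i j → suc i ℕ.* suc (2 ℕ.* j) ℕ.≤ 2 ℕ.* n → j ℕ.< nearest n i
  ⇒<nearest n i j h = m*d≤a⇒m≤a/d (2 ℕ.* suc i)
    (subst (ℕ._≤ 2 ℕ.* n ℕ.+ suc i) (sym (rearrange i j)) (ℕ.+-monoˡ-≤ (suc i) h))

  -- Both sides are the indicator of (i + 1)(2j + 1) ≤ 2n, read as a bound on j or as a bound on i.
  -- This makes the inner sum over i a quotient once the sums are exchanged.
  below-nearest : ∀ n i j → below (nearest n i) j ≡ below (2 ℕ.* n ℕ./ suc (2 ℕ.* j)) i
  below-nearest n i j = ℚ.≤-antisym
    (below-mono (nearest n i) j _ i λ h → m*d≤a⇒m≤a/d (suc (2 ℕ.* j)) (<nearest⇒ n i j h))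
    (below-mono _ i (nearest n i) j λ h → ⇒<nearest n i j (m≤a/d⇒m*d≤a (suc (2 ℕ.* j)) h))

  ⌊/⌋-≈ : ∀ a d → ι (a ℕ./ suc d) ≈ ι a * 1/suc d ± 1ℚ
  ⌊/⌋-≈ a d = within (ℚ.≤-trans lower′ (≤-difference 0≤1 refl)) upper′
    where
    k = suc d
    q = a ℕ./ k
    expand : ∀ m → ι m ≡ ι (m ℕ.* k) * 1/suc d
    expand m = begin
      ι m                       ≡⟨ ℚ.*-identityʳ (ι m) ⟨
      ι m * 1ℚ                  ≡⟨ cong (ι m *_) (trans (ℚ.*-comm (ι k) (1/suc d)) (1/suc-inverse d)) ⟨
      ι m * (ι k * 1/suc d)     ≡⟨ ℚ.*-assoc (ι m) (ι k) (1/suc d) ⟨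
      ι m * ι k * 1/suc d       ≡⟨ cong (_* 1/suc d) (ι-* m k) ⟨
      ι (m ℕ.* k) * 1/suc d ∎
      where open ≡-Reasoning
    mono : ∀ {m n} → m ℕ.≤ n → ι m * 1/suc d ≤ ι n * 1/suc d
    mono {m} {n} h = *-mono-≤ (0≤ι m) (0≤/ 1 k) (ι-mono-≤ h) ℚ.≤-refl
    lower′ : ι q ≤ ι a * 1/suc d
    lower′ = ℚ.≤-trans (ℚ.≤-reflexive (expand q)) (mono (ℕ.m/n*n≤m a k))
    upper′ : ι a * 1/suc d ≤ ι q + 1ℚ
    upper′ = ℚ.≤-trans (mono (ℕ.<⇒≤ a<))
      (ℚ.≤-reflexive (trans (sym (expand (suc q))) (trans (ι-suc q) (ℚ.+-comm 1ℚ (ι q)))))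
      where
      a< : a ℕ.< suc q ℕ.* k
      a< = subst (ℕ._< suc q ℕ.* k) (sym (ℕ.m≡m%n+[m/n]*n a k))
        (ℕ.+-monoˡ-< (q ℕ.* k) (ℕ.m%n<n a k))

  leibniz : ℕ → ℚ
  leibniz J = alt J (λ j → 1/suc (2 ℕ.* j))

  -- At most n multiples of 2j + 1 are counted, which is a restriction for j = 0
  -- only: this is the correction term below 1 j.
  count-≈ : ∀ n j → ∑ n (below (2 ℕ.* n ℕ./ suc (2 ℕ.* j))) ≈
    ι (2 ℕ.* n) * 1/suc (2 ℕ.* j) - ι n * below 1 j ± 1ℚ
  count-≈ n zero = ≈-weaken 0≤1 (≈-refl (begin
    ∑ n (below (2 ℕ.* n ℕ./ 1))      ≡⟨ ∑-below n _ ⟩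
    ι (n ℕ.⊓ (2 ℕ.* n ℕ./ 1))        ≡⟨ cong (λ m → ι (n ℕ.⊓ m)) (ℕ.n/1≡n (2 ℕ.* n)) ⟩
    ι (n ℕ.⊓ (2 ℕ.* n))              ≡⟨ cong ι (ℕ.m≤n⇒m⊓n≡m (ℕ.m≤m+n n _)) ⟩
    ι n                              ≡⟨ lemma (ι n) ⟩
    (1ℚ + 1ℚ) * ι n * 1ℚ - ι n * 1ℚ  ≡⟨ cong (λ z → z * 1ℚ - ι n * 1ℚ) (ι-* 2 n) ⟨
    ι (2 ℕ.* n) * 1ℚ - ι n * 1ℚ ∎))
    where
    open ≡-Reasoning
    lemma : ∀ a → a ≡ (1ℚ + 1ℚ) * a * 1ℚ - a * 1ℚ
    lemma = solve-∀ ring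
  count-≈ n (suc j) = subst₂ (_≈_± 1ℚ)
    (sym (trans (∑-below n q) (cong ι (ℕ.m≥n⇒m⊓n≡n q≤n))))
    (lemma (ι (2 ℕ.* n) * 1/suc d) (ι n))
    (⌊/⌋-≈ (2 ℕ.* n) d)
    where
    d = 2 ℕ.* suc j
    q = 2 ℕ.* n ℕ./ suc d
    q≤n : q ℕ.≤ n
    q≤n = subst (q ℕ.≤_) (trans (ℕ./-congˡ (ℕ.*-comm 2 n)) (ℕ.m*n/n≡m n 2))
      (ℕ./-monoʳ-≤ (2 ℕ.* n) (s≤s (ℕ.≤-trans (s≤s z≤n) (ℕ.m≤m+n (suc j) _))))
    lemma : ∀ a b → a ≡ a - b * 0ℚ
    lemma = solve-∀ ring

  -- One `ι J` pays for cutting the parity sums off after J terms, the other for a floor error of at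
  -- most 1 in each of the J remaining counts.
  𝓡-≈-leibniz : ∀ n J .{{_ : NonZero J}} → 2 ℕ.* n ℕ.< suc J ℕ.* suc J →
    ι (𝓡 n) ≈ ι (2 ℕ.* n) * leibniz J - ι n ± (ι J + ι J)
  𝓡-≈-leibniz n J@(suc J-1) 2n< = subst₂ (_≈_± (ι J + ι J)) (sym (𝓡≡∑parity n)) main
    (≈-trans
      (≈-weaken near (∑-≈ n λ i → parity-≈-alt (nearest n i) J))
      (subst (_≈ alt J target ± ι J) (sym swap)
        (subst (alt J count ≈ alt J target ±_) (∑-1 J) (alt-≈ J (count-≈ n)))))
    where
    count target : ℕ → ℚ
    count j  = ∑ n (below (2 ℕ.* n ℕ./ suc (2 ℕ.* j)))
    target j = ι (2 ℕ.* n) * 1/suc (2 ℕ.* j) - ι n * below 1 j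
    near : ∑ n (λ i → below (nearest n i) J) ≤ ι J
    near = ℚ.≤-trans
      -- If J < `nearest n i` and J ≤ i, then (J + 1)² ≤ (i + 1)(2J + 1) ≤ 2n, against the
      -- hypothesis; so only the indices i < J are affected.
      (∑-mono-≤ n λ i → below-mono (nearest n i) J J i λ h → ℕ.≰⇒> λ J≤i →
        ℕ.<⇒≱ 2n< (ℕ.≤-trans
          (ℕ.*-mono-≤ (s≤s J≤i) (s≤s (ℕ.m≤m+n J _)))
          (<nearest⇒ n i J h)))
      (ℚ.≤-trans (ℚ.≤-reflexive (∑-below n J)) (ι-mono-≤ (ℕ.m⊓n≤n n J)))
    swap : ∑ n (λ i → alt J (below (nearest n i))) ≡ alt J count
    swap = trans (∑-alt-swap n J λ i j → below (nearest n i) j)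
      (alt-cong J λ j → ∑-cong n λ i → below-nearest n i j)
    main : alt J target ≡ ι (2 ℕ.* n) * leibniz J - ι n
    main = trans (alt-- J (λ j → ι (2 ℕ.* n) * 1/suc (2 ℕ.* j)) (λ j → ι n * below 1 j))
      (cong₂ _-_ (alt-* J (ι (2 ℕ.* n)) (λ j → 1/suc (2 ℕ.* j)))
      -- `below 1` is 1 at 0 and 0 elsewhere, so its alternating sum is 1 because J is nonzero.
      (trans (alt-* J (ι n) (below 1))
        (trans (cong (λ z → ι n * (1ℚ - z)) (alt-0 J-1)) (ℚ.*-identityʳ (ι n)))))

  -- The Taylor polynomial of arctan

  pow : ℚ → ℕ → ℚ
  pow p zero    = 1ℚ
  pow p (suc n) = p * pow p n

  0≤pow : ∀ {p} n → 0ℚ ≤ p → 0ℚ ≤ pow p n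
  0≤pow zero    h = 0≤1
  0≤pow (suc n) h = 0≤p*q h (0≤pow n h)

  pow-mono : ∀ {p q} n → 0ℚ ≤ p → p ≤ q → pow p n ≤ pow q n
  pow-mono zero    0≤p p≤q = ℚ.≤-refl
  pow-mono (suc n) 0≤p p≤q = *-mono-≤ 0≤p (0≤pow n 0≤p) p≤q (pow-mono n 0≤p p≤q)

  pow-1 : ∀ n → pow 1ℚ n ≡ 1ℚ
  pow-1 zero    = refl
  pow-1 (suc n) = trans (ℚ.*-identityˡ _) (pow-1 n)

  pow-+ : ∀ p m n → pow p (m ℕ.+ n) ≡ pow p m * pow p n
  pow-+ p zero    n = sym (ℚ.*-identityˡ _)
  pow-+ p (suc m) n = trans (cong (p *_) (pow-+ p m n)) (sym (ℚ.*-assoc p _ _))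

  pow-double : ∀ p n → pow p (2 ℕ.* n) ≡ pow (p * p) n
  pow-double p n = trans (pow-+ p n (n ℕ.+ 0))
    (trans (cong (λ k → pow p n * pow p k) (ℕ.+-identityʳ n)) (square n))
    where
    lemma : ∀ p x → p * x * (p * x) ≡ p * p * (x * x)
    lemma = solve-∀ ring
    square : ∀ n → pow p n * pow p n ≡ pow (p * p) n
    square zero    = refl
    square (suc n) = trans (lemma p (pow p n)) (cong (p * p *_) (square n))

  -- The left side is 1 - (-q)^n; only the size of the remainder matters, not its sign.
  geometric-≈ : ∀ q → 0ℚ ≤ q → ∀ n → (1ℚ + q) * alt n (pow q) ≈ 1ℚ ± pow q n
  geometric-≈ q 0≤q zero = subst (_≈ 1ℚ ± 1ℚ) (sym (ℚ.*-zeroʳ (1ℚ + q)))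
    (within (≤-difference (0≤p+q 0≤1 0≤1) refl) ℚ.≤-refl)
  geometric-≈ q 0≤q (suc n) = subst₂ (_≈_± q * pow q n)
    (trans (lemma₁ q (alt n (pow q))) (cong (λ z → (1ℚ + q) * (1ℚ - z)) (sym (alt-* n q (pow q)))))
    (lemma₂ q)
    (subst (1ℚ + q - q * ((1ℚ + q) * alt n (pow q)) ≈ 1ℚ + q - q * 1ℚ ±_) (ℚ.+-identityˡ _)
      (≈-- (≈-refl {1ℚ + q} refl) (≈-* q 0≤q (geometric-≈ q 0≤q n))))
    where
    lemma₁ : ∀ q a → 1ℚ + q - q * ((1ℚ + q) * a) ≡ (1ℚ + q) * (1ℚ - q * a)
    lemma₁ = solve-∀ ring
    lemma₂ : ∀ q → 1ℚ + q - q * 1ℚ ≡ 1ℚ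
    lemma₂ = solve-∀ ring

  -- A non-negative u with u (1 + s²) = 1 stands for 1 / (1 + s²).
  u≤1 : ∀ {s u} → 0ℚ ≤ s → 0ℚ ≤ u → u * (1ℚ + s * s) ≡ 1ℚ → u ≤ 1ℚ
  u≤1 {s} {u} 0≤s 0≤u eq = ≤-difference (0≤p*q 0≤u (0≤p*q 0≤s 0≤s)) (trans (lemma u s) eq)
    where
    lemma : ∀ u s → u + u * (s * s) ≡ u * (1ℚ + s * s)
    lemma = solve-∀ ring

  private
    -- A mean value bound by induction on the exponent, from t^(m+2) - s^(m+2) = t (t^(m+1) -
    -- s^(m+1)) + (t - s) s^(m+1); `step-upper` uses the same splitting.
    step-lower : ∀ {s t} → 0ℚ ≤ s → s ≤ t → ∀ m →
      ι (suc m) * (t - s) * pow s m ≤ pow t (suc m) - pow s (suc m)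
    step-lower {s} {t} 0≤s s≤t zero = ℚ.≤-reflexive (lemma s t)
      where
      lemma : ∀ s t → 1ℚ * (t - s) * 1ℚ ≡ t * 1ℚ - s * 1ℚ
      lemma = solve-∀ ring
    step-lower {s} {t} 0≤s s≤t (suc m) = begin
      ι (suc (suc m)) * (t - s) * pow s (suc m)
        ≡⟨ cong (λ z → z * (t - s) * pow s (suc m)) (ι-suc (suc m)) ⟩
      (1ℚ + ι (suc m)) * (t - s) * (s * pow s m)
        ≡⟨ lemma₁ (ι (suc m)) s t (pow s m) ⟩
      s * (ι (suc m) * (t - s) * pow s m) + (t - s) * (s * pow s m)
        ≤⟨ ℚ.+-monoˡ-≤ _ (*-mono-≤ 0≤s
             (0≤p*q (0≤p*q (0≤ι (suc m)) (p≤q⇒0≤q-p s≤t)) (0≤pow m 0≤s))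
             s≤t (step-lower 0≤s s≤t m)) ⟩
      t * (t * pow t m - s * pow s m) + (t - s) * (s * pow s m)
        ≡⟨ lemma₂ s t (pow s m) (pow t m) ⟩
      t * (t * pow t m) - s * (s * pow s m) ∎
      where
      open ℚ.≤-Reasoning
      lemma₁ : ∀ i s t x → (1ℚ + i) * (t - s) * (s * x) ≡ s * (i * (t - s) * x) + (t - s) * (s * x)
      lemma₁ = solve-∀ ring
      lemma₂ : ∀ s t x y → t * (t * y - s * x) + (t - s) * (s * x) ≡ t * (t * y) - s * (s * x)
      lemma₂ = solve-∀ ring

    step-upper : ∀ {s t} → 0ℚ ≤ s → s ≤ t → ∀ m →
      pow t (suc m) - pow s (suc m) ≤ ι (suc m) * (t - s) * pow t m
    step-upper {s} {t} 0≤s s≤t zero = ℚ.≤-reflexive (lemma s t)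
      where
      lemma : ∀ s t → t * 1ℚ - s * 1ℚ ≡ 1ℚ * (t - s) * 1ℚ
      lemma = solve-∀ ring
    step-upper {s} {t} 0≤s s≤t (suc m) = begin
      t * (t * pow t m) - s * (s * pow s m)
        ≡⟨ lemma₂ s t (pow s m) (pow t m) ⟩
      t * (t * pow t m - s * pow s m) + (t - s) * (s * pow s m)
        ≤⟨ ℚ.+-mono-≤ (*-monoˡ-≤ (ℚ.≤-trans 0≤s s≤t) (step-upper 0≤s s≤t m))
             (*-monoˡ-≤ (p≤q⇒0≤q-p s≤t) (pow-mono (suc m) 0≤s s≤t)) ⟩
      t * (ι (suc m) * (t - s) * pow t m) + (t - s) * (t * pow t m)
        ≡⟨ lemma₁ (ι (suc m)) s t (pow t m) ⟨
      (1ℚ + ι (suc m)) * (t - s) * (t * pow t m)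
        ≡⟨ cong (λ z → z * (t - s) * pow t (suc m)) (ι-suc (suc m)) ⟨
      ι (suc (suc m)) * (t - s) * pow t (suc m) ∎
      where
      open ℚ.≤-Reasoning
      lemma₁ : ∀ i s t x → (1ℚ + i) * (t - s) * (t * x) ≡ t * (i * (t - s) * x) + (t - s) * (t * x)
      lemma₁ = solve-∀ ring
      lemma₂ : ∀ s t x y → t * (t * y) - s * (s * x) ≡ t * (t * y - s * x) + (t - s) * (s * x)
      lemma₂ = solve-∀ ring

  -- The antiderivative of t^m; its increment over [s, t] stands for the integral, which
  -- `monomial-≈` compares with the rectangle at the left end.
  monomial : ℕ → ℚ → ℚ
  monomial m t = 1/suc m * pow t (suc m)

  private
    cancel-1/suc : ∀ m h x → 1/suc m * (ι (suc m) * h * x) ≡ h * x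
    cancel-1/suc m h x = trans (lemma (1/suc m) (ι (suc m)) h x)
      (trans (cong (_* (h * x)) (1/suc-inverse m)) (ℚ.*-identityˡ _))
      where
      lemma : ∀ c i h x → c * (i * h * x) ≡ c * i * (h * x)
      lemma = solve-∀ ring

  monomial-lower : ∀ {s t} m → 0ℚ ≤ s → s ≤ t → (t - s) * pow s m ≤ monomial m t - monomial m s
  monomial-lower {s} {t} m 0≤s s≤t = subst₂ _≤_ (cancel-1/suc m (t - s) (pow s m))
    (*-distribˡ-- (1/suc m) (pow t (suc m)) (pow s (suc m)))
    (*-monoˡ-≤ (0≤/ 1 (suc m)) (step-lower 0≤s s≤t m))

  monomial-upper : ∀ {s t} m → 0ℚ ≤ s → s ≤ t → monomial m t - monomial m s ≤ (t - s) * pow t m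
  monomial-upper {s} {t} m 0≤s s≤t = subst₂ _≤_
    (*-distribˡ-- (1/suc m) (pow t (suc m)) (pow s (suc m))) (cancel-1/suc m (t - s) (pow t m))
    (*-monoˡ-≤ (0≤/ 1 (suc m)) (step-upper 0≤s s≤t m))

  monomial-≈ : ∀ {s t} m → 0ℚ ≤ s → s ≤ t →
    monomial m t - monomial m s ≈ (t - s) * pow s m ± (t - s) * (pow t m - pow s m)
  monomial-≈ {s} {t} m 0≤s s≤t = within
    (ℚ.≤-trans (monomial-upper m 0≤s s≤t) (ℚ.≤-reflexive (lemma (t - s) (pow s m) (pow t m))))
    (ℚ.≤-trans (monomial-lower m 0≤s s≤t)
      (≤-difference (0≤p*q (p≤q⇒0≤q-p s≤t) (p≤q⇒0≤q-p (pow-mono m 0≤s s≤t))) refl))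
    where
    lemma : ∀ h x y → h * y ≡ h * x + h * (y - x)
    lemma = solve-∀ ring

  arctan : ℕ → ℚ → ℚ
  arctan J t = alt J (λ j → monomial (2 ℕ.* j) t)

  -- The derivative of `arctan J` with all signs made positive: it is increasing for t ≥ 0, and its
  -- increments collect the rectangle errors of all terms at once.
  evenPowers : ℕ → ℚ → ℚ
  evenPowers J t = ∑ J (λ j → pow t (2 ℕ.* j))

  -- The first error replaces the integral of the derivative by its value at s, the second replaces
  -- that value by 1 / (1 + s²). The latter, (t - s) s^(2J), is enlarged to an increment of t^(2J+1)
  -- / (2J + 1), so that it telescopes to the next Leibniz term.
  arctan-step : ∀ J {s t u} → 0ℚ ≤ s → s ≤ t → 0ℚ ≤ u → u * (1ℚ + s * s) ≡ 1ℚ →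
    arctan J t - arctan J s ≈ (t - s) * u ±
      ((t - s) * (evenPowers J t - evenPowers J s) + (monomial (2 ℕ.* J) t - monomial (2 ℕ.* J) s))
  arctan-step J {s} {t} {u} 0≤s s≤t 0≤u u≡ = ≈-trans
    (subst₂ (λ p e → p ≈ h * alt J (λ j → pow s (2 ℕ.* j)) ± e)
      (alt-- J (λ j → monomial (2 ℕ.* j) t) (λ j → monomial (2 ℕ.* j) s))
      (trans (∑-* J h (λ j → pow t (2 ℕ.* j) - pow s (2 ℕ.* j)))
        (cong (h *_) (∑-- J (λ j → pow t (2 ℕ.* j)) (λ j → pow s (2 ℕ.* j)))))
      (subst (alt J (λ j → monomial (2 ℕ.* j) t - monomial (2 ℕ.* j) s) ≈_±
        ∑ J (λ j → h * (pow t (2 ℕ.* j) - pow s (2 ℕ.* j))))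
        (alt-* J h (λ j → pow s (2 ℕ.* j)))
        (alt-≈ J λ j → monomial-≈ (2 ℕ.* j) 0≤s s≤t)))
    (≈-weaken (monomial-lower (2 ℕ.* J) 0≤s s≤t)
      (≈-* h (p≤q⇒0≤q-p s≤t) series))
    where
    h = t - s
    0≤ss = 0≤p*q 0≤s 0≤s
    lemma : ∀ u q a → u * ((1ℚ + q) * a) ≡ u * (1ℚ + q) * a
    lemma = solve-∀ ring
    series : alt J (λ j → pow s (2 ℕ.* j)) ≈ u ± pow s (2 ℕ.* J)
    series = subst₂ (_≈_± pow s (2 ℕ.* J))
      (trans (lemma u (s * s) _) (trans (cong (_* alt J (pow (s * s))) u≡)
        (trans (ℚ.*-identityˡ _) (alt-cong J λ j → sym (pow-double s j)))))
      (ℚ.*-identityʳ u)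
      (≈-weaken
        (ℚ.≤-trans
          (*-mono-≤ 0≤u (0≤pow J 0≤ss) (u≤1 0≤s 0≤u u≡) ℚ.≤-refl)
          (ℚ.≤-reflexive (trans (ℚ.*-identityˡ _) (sym (pow-double s J)))))
        (≈-* u 0≤u (geometric-≈ (s * s) 0≤ss J)))

  arctan-0 : ∀ J → arctan J 0ℚ ≡ 0ℚ
  arctan-0 J = trans (alt-cong J λ j → lemma (1/suc (2 ℕ.* j)) (pow 0ℚ (2 ℕ.* j))) (alt-0 J)
    where
    lemma : ∀ c x → c * (0ℚ * x) ≡ 0ℚ
    lemma = solve-∀ ring

  arctan-1 : ∀ J → arctan J 1ℚ ≡ leibniz J
  arctan-1 J = alt-cong J λ j →
    trans (cong (1/suc (2 ℕ.* j) *_) (pow-1 (suc (2 ℕ.* j)))) (ℚ.*-identityʳ _)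

  -- A sector of the unit disc

  2ℚ 4ℚ : ℚ
  2ℚ = 1ℚ + 1ℚ
  4ℚ = 2ℚ + 2ℚ

  -- With u = 1 / (1 + t²), the point of the unit circle at the angle 2 arctan t
  -- is (abscissa t u , 2 · halfOrdinate t u).
  abscissa halfOrdinate : ℚ → ℚ → ℚ
  abscissa t u     = (1ℚ - t * t) * u
  halfOrdinate t u = t * u

  module Sector {s t u v : ℚ} (0≤s : 0ℚ ≤ s) (s≤t : s ≤ t) (t≤1 : t ≤ 1ℚ)
    (0≤u : 0ℚ ≤ u) (0≤v : 0ℚ ≤ v)
    (u≡ : u * (1ℚ + s * s) ≡ 1ℚ) (v≡ : v * (1ℚ + t * t) ≡ 1ℚ) where

    h X X′ Y Y′ : ℚ
    h  = t - s
    X  = abscissa s u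
    X′ = abscissa t v
    Y  = halfOrdinate s u
    Y′ = halfOrdinate t v

    0≤h : 0ℚ ≤ h
    0≤h = p≤q⇒0≤q-p s≤t

    0≤t : 0ℚ ≤ t
    0≤t = ℚ.≤-trans 0≤s s≤t

    0≤uv : 0ℚ ≤ u * v
    0≤uv = 0≤p*q 0≤u 0≤v

    -- Writing 1 as the defining equation of the other point puts both fractions on a common
    -- denominator and leaves a ring identity.
    X-X′ : X - X′ ≡ 2ℚ * (u * v) * ((s + t) * h)
    X-X′ = begin
      X - X′                                            ≡⟨ lemma₁ X X′ ⟩
      X * 1ℚ - X′ * 1ℚ                                  ≡⟨ cong₂ (λ p q → X * q - X′ * p) u≡ v≡ ⟨
      X * (v * (1ℚ + t * t)) - X′ * (u * (1ℚ + s * s))  ≡⟨ lemma₂ s t u v ⟩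
      2ℚ * (u * v) * ((s + t) * h) ∎
      where
      open ≡-Reasoning
      lemma₁ : ∀ x y → x - y ≡ x * 1ℚ - y * 1ℚ
      lemma₁ = solve-∀ ring
      lemma₂ : ∀ s t u v →
        (1ℚ - s * s) * u * (v * (1ℚ + t * t)) - (1ℚ - t * t) * v * (u * (1ℚ + s * s)) ≡
        (1ℚ + 1ℚ) * (u * v) * ((s + t) * (t - s))
      lemma₂ = solve-∀ ring

    Y′-Y : Y′ - Y ≡ u * v * ((1ℚ - s * t) * h)
    Y′-Y = begin
      Y′ - Y                                            ≡⟨ lemma₁ Y′ Y ⟩
      Y′ * 1ℚ - Y * 1ℚ                                  ≡⟨ cong₂ (λ p q → Y′ * p - Y * q) u≡ v≡ ⟨
      Y′ * (u * (1ℚ + s * s)) - Y * (v * (1ℚ + t * t))  ≡⟨ lemma₂ s t u v ⟩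
      u * v * ((1ℚ - s * t) * h) ∎
      where
      open ≡-Reasoning
      lemma₁ : ∀ x y → x - y ≡ x * 1ℚ - y * 1ℚ
      lemma₁ = solve-∀ ring
      lemma₂ : ∀ s t u v →
        t * v * (u * (1ℚ + s * s)) - s * u * (v * (1ℚ + t * t)) ≡ u * v * ((1ℚ - s * t) * (t - s))
      lemma₂ = solve-∀ ring

    -- The columns miss the sector by at most (Y′ - Y)(X - X′) beyond the triangle between the
    -- radii. Bounding only the width, by u v ≤ 1 and s + t ≤ 2, keeps the increment of Y and lets
    -- these errors telescope.
    X-X′≤4h : X - X′ ≤ 4ℚ * h
    X-X′≤4h = begin
      X - X′                       ≡⟨ X-X′ ⟩
      2ℚ * (u * v) * ((s + t) * h) ≤⟨ *-mono-≤ (0≤p*q (0≤p+q 0≤1 0≤1) 0≤uv) (0≤p*q (0≤p+q 0≤s 0≤t) 0≤h)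
                                        (*-monoˡ-≤ (0≤p+q 0≤1 0≤1) (*-mono-≤ 0≤u 0≤v (u≤1 0≤s 0≤u u≡) (u≤1 0≤t 0≤v v≡)))
                                        (*-mono-≤ (0≤p+q 0≤s 0≤t) 0≤h (ℚ.+-mono-≤ (ℚ.≤-trans s≤t t≤1) t≤1) ℚ.≤-refl) ⟩
      2ℚ * (1ℚ * 1ℚ) * (2ℚ * h)    ≡⟨ lemma h ⟩
      4ℚ * h ∎
      where
      open ℚ.≤-Reasoning
      lemma : ∀ h → (1ℚ + 1ℚ) * (1ℚ * 1ℚ) * ((1ℚ + 1ℚ) * h) ≡ (1ℚ + 1ℚ + (1ℚ + 1ℚ)) * h
      lemma = solve-∀ ring

    0≤Y′-Y : 0ℚ ≤ Y′ - Y
    0≤Y′-Y = subst (0ℚ ≤_) (sym Y′-Y) (0≤p*q 0≤uv (0≤p*q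
      (p≤q⇒0≤q-p (ℚ.≤-trans (*-mono-≤ 0≤s 0≤t (ℚ.≤-trans s≤t t≤1) t≤1) (ℚ.≤-reflexive (ℚ.*-identityˡ 1ℚ)))) 0≤h))

    -- The left side is the area of the triangle spanned by the two radii, since the ordinates are
    -- 2Y and 2Y′. It equals u v h (1 + s t), which lies between u v h (1 + s²) = h v and u v h (1 +
    -- t²) = h u.
    cross≤ : X * Y′ - X′ * Y ≤ h * u
    cross≤ = ≤-difference (0≤p*q (0≤p*q 0≤uv 0≤h) (0≤p*q 0≤t 0≤h))
      (trans (lemma s t u v) (trans (cong ((t - s) * u *_) v≡) (ℚ.*-identityʳ _)))
      where
      lemma : ∀ s t u v →
        (1ℚ - s * s) * u * (t * v) - (1ℚ - t * t) * v * (s * u) + u * v * (t - s) * (t * (t - s)) ≡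
        (t - s) * u * (v * (1ℚ + t * t))
      lemma = solve-∀ ring

    ≤cross : h * v ≤ X * Y′ - X′ * Y
    ≤cross = ≤-difference (0≤p*q (0≤p*q 0≤uv 0≤h) (0≤p*q 0≤s 0≤h))
      (trans (cong (_+ u * v * (t - s) * (s * (t - s)))
        (trans (sym (ℚ.*-identityʳ (h * v))) (cong (h * v *_) (sym u≡)))) (lemma s t u v))
      where
      lemma : ∀ s t u v →
        (t - s) * v * (u * (1ℚ + s * s)) + u * v * (t - s) * (s * (t - s)) ≡
        (1ℚ - s * s) * u * (t * v) - (1ℚ - t * t) * v * (s * u)
      lemma = solve-∀ ring

    0≤u-v : 0ℚ ≤ h * (u - v)
    0≤u-v = subst (0ℚ ≤_) (lemma h u v) (p≤q⇒0≤q-p (ℚ.≤-trans ≤cross cross≤))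
      where
      lemma : ∀ h u v → h * u - h * v ≡ h * (u - v)
      lemma = solve-∀ ring

    -- The area Δ of the columns over [X′, X], less the triangles cut off by
    -- the radii at both ends, is that of the sector between the radii.
    sector-≈ : ∀ {Δ} → 2ℚ * Y * (X - X′) ≤ Δ → Δ ≤ 2ℚ * Y′ * (X - X′) →
      Δ - (X * Y - X′ * Y′) ≈ h * u ± (4ℚ * h * (Y′ - Y) + h * (u - v))
    sector-≈ {Δ} ≤Δ Δ≤ = within
      (≤-difference
        (0≤p+q (0≤p+q (p≤q⇒0≤q-p Δ≤) (p≤q⇒0≤q-p cross≤))
          (0≤p+q (0≤p*q 0≤Y′-Y (p≤q⇒0≤q-p X-X′≤4h)) 0≤u-v))
        (lemma₁ Δ X X′ Y Y′ (h * u) h (h * (u - v))))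
      (≤-difference
        (0≤p+q (0≤p+q (p≤q⇒0≤q-p ≤Δ) (p≤q⇒0≤q-p ≤cross))
          (0≤p*q 0≤Y′-Y (p≤q⇒0≤q-p X-X′≤4h)))
        (lemma₂ Δ X X′ Y Y′ u v h))
      where
      lemma₁ : ∀ Δ X X′ Y Y′ a h b →
        Δ - (X * Y - X′ * Y′) +
          ((((1ℚ + 1ℚ) * Y′ * (X - X′) - Δ) + (a - (X * Y′ - X′ * Y))) +
          ((Y′ - Y) * ((1ℚ + 1ℚ + (1ℚ + 1ℚ)) * h - (X - X′)) + b)) ≡
        a + ((1ℚ + 1ℚ + (1ℚ + 1ℚ)) * h * (Y′ - Y) + b)
      lemma₁ = solve-∀ ring
      lemma₂ : ∀ Δ X X′ Y Y′ u v h →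
        h * u + (((Δ - (1ℚ + 1ℚ) * Y * (X - X′)) + ((X * Y′ - X′ * Y) - h * v)) +
          ((Y′ - Y) * ((1ℚ + 1ℚ + (1ℚ + 1ℚ)) * h - (X - X′)))) ≡
        Δ - (X * Y - X′ * Y′) + ((1ℚ + 1ℚ + (1ℚ + 1ℚ)) * h * (Y′ - Y) + h * (u - v))
      lemma₂ = solve-∀ ring

  -- The lattice count of the quarter disc

  square-cancel-< : ∀ {m n} → m ℕ.* m ℕ.< n ℕ.* n → m ℕ.< n
  square-cancel-< h = ℕ.≰⇒> λ n≤m → ℕ.<⇒≱ h (ℕ.*-mono-≤ n≤m n≤m)

  ⌊√⌋-greatest : ∀ {m n} → m ℕ.* m ℕ.≤ n → m ℕ.≤ ⌊√ n ⌋
  ⌊√⌋-greatest {m} {n} h = ℕ.s≤s⁻¹ (square-cancel-< (ℕ.≤-<-trans h (⌊√⌋-upper n)))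

  ⌊√⌋-mono : ∀ {m n} → m ℕ.≤ n → ⌊√ m ⌋ ℕ.≤ ⌊√ n ⌋
  ⌊√⌋-mono {m} h = ⌊√⌋-greatest (ℕ.≤-trans (⌊√⌋-lower m) h)

  ⌊√n*n⌋≡n : ∀ n → ⌊√ n ℕ.* n ⌋ ≡ n
  ⌊√n*n⌋≡n n = ℕ.≤-antisym
    (ℕ.≮⇒≥ λ n<√ → ℕ.<⇒≱ (ℕ.*-mono-< n<√ n<√) (⌊√⌋-lower (n ℕ.* n)))
    (⌊√⌋-greatest ℕ.≤-refl)

  -- At a lattice point of the circle the integer square root is exact, so no rounding enters.
  column-≡ : ∀ M X Y → X ℕ.* X ℕ.+ Y ℕ.* Y ≡ M ℕ.* M → column M X ≡ Y
  column-≡ M X Y eq = trans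
    (cong ⌊√_⌋ (trans (cong (ℕ._∸ X ℕ.* X) (sym eq)) (ℕ.m+n∸m≡n (X ℕ.* X) (Y ℕ.* Y))))
    (⌊√n*n⌋≡n Y)

  column-antitone : ∀ M {X X′} → X′ ℕ.≤ X → column M X ℕ.≤ column M X′
  column-antitone M h = ⌊√⌋-mono (ℕ.∸-monoʳ-≤ (M ℕ.* M) (ℕ.*-mono-≤ h h))

  sum-applyUpTo-suc : ∀ f n → sum (applyUpTo f (suc n)) ≡ sum (applyUpTo f n) ℕ.+ f n
  sum-applyUpTo-suc f zero    = ℕ.+-identityʳ (f 0)
  sum-applyUpTo-suc f (suc n) = trans (cong (f 0 ℕ.+_) (sum-applyUpTo-suc (λ i → f (suc i)) n))
    (sym (ℕ.+-assoc (f 0) _ _))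

  -- A partial sum of `quarterDisc M`, which is `columns M M` by definition.
  columns : ℕ → ℕ → ℕ
  columns M X = sum (applyUpTo (λ i → column M (suc i)) X)

  columns-lower : ∀ M X k →
    columns M X ℕ.+ k ℕ.* column M (k ℕ.+ X) ℕ.≤ columns M (k ℕ.+ X)
  columns-lower M X zero    = ℕ.≤-reflexive (ℕ.+-identityʳ _)
  columns-lower M X (suc k) = begin
    columns M X ℕ.+ (c′ ℕ.+ k ℕ.* c′)   ≤⟨ ℕ.+-monoʳ-≤ (columns M X) (ℕ.+-monoʳ-≤ c′ (ℕ.*-monoʳ-≤ k (column-antitone M {suc k ℕ.+ X} {k ℕ.+ X} (ℕ.n≤1+n _)))) ⟩
    columns M X ℕ.+ (c′ ℕ.+ k ℕ.* c)    ≡⟨ lemma (columns M X) c′ (k ℕ.* c) ⟩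
    columns M X ℕ.+ k ℕ.* c ℕ.+ c′      ≤⟨ ℕ.+-monoˡ-≤ c′ (columns-lower M X k) ⟩
    columns M (k ℕ.+ X) ℕ.+ c′          ≡⟨ sum-applyUpTo-suc (λ i → column M (suc i)) (k ℕ.+ X) ⟨
    columns M (suc k ℕ.+ X) ∎
    where
    open ℕ.≤-Reasoning
    c = column M (k ℕ.+ X)
    c′ = column M (suc k ℕ.+ X)
    lemma : ∀ a b c → a ℕ.+ (b ℕ.+ c) ≡ a ℕ.+ c ℕ.+ b
    lemma = ℕ-Solver.solve-∀

  columns-upper : ∀ M X k →
    columns M (k ℕ.+ X) ℕ.≤ columns M X ℕ.+ k ℕ.* column M X
  columns-upper M X zero    = ℕ.≤-reflexive (sym (ℕ.+-identityʳ _))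
  columns-upper M X (suc k) = begin
    columns M (suc k ℕ.+ X)             ≡⟨ sum-applyUpTo-suc (λ i → column M (suc i)) (k ℕ.+ X) ⟩
    columns M (k ℕ.+ X) ℕ.+ c′          ≤⟨ ℕ.+-mono-≤ (columns-upper M X k) (column-antitone M {suc k ℕ.+ X} {X} (ℕ.m≤n+m X (suc k))) ⟩
    columns M X ℕ.+ k ℕ.* c ℕ.+ c       ≡⟨ lemma (columns M X) c (k ℕ.* c) ⟨
    columns M X ℕ.+ (c ℕ.+ k ℕ.* c) ∎
    where
    open ℕ.≤-Reasoning
    c = column M X
    c′ = column M (suc k ℕ.+ X)
    lemma : ∀ a b c → a ℕ.+ (b ℕ.+ c) ≡ a ℕ.+ c ℕ.+ b
    lemma = ℕ-Solver.solve-∀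

  ι-∸ : ∀ {m n} → n ℕ.≤ m → ι (m ℕ.∸ n) ≡ ι m - ι n
  ι-∸ {m} {n} n≤m = trans (lemma (ι n) _)
    (cong (_- ι n) (trans (sym (ι-+ n (m ℕ.∸ n))) (cong ι (ℕ.m+[n∸m]≡n n≤m))))
    where
    lemma : ∀ a b → b ≡ a + b - a
    lemma = solve-∀ ring

  module _ (M : ℕ) {X X′ : ℕ} (X′≤X : X′ ℕ.≤ X) where
    private
      k = X ℕ.∸ X′
      k+X′≡X : k ℕ.+ X′ ≡ X
      k+X′≡X = ℕ.m∸n+n≡m X′≤X

    ι-columns-lower : ι (column M X) * (ι X - ι X′) ≤ ι (columns M X) - ι (columns M X′)
    ι-columns-lower = ≤-difference (p≤q⇒0≤q-p (ι-mono-≤ (subst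
        (λ Z → columns M X′ ℕ.+ k ℕ.* column M Z ℕ.≤ columns M Z) k+X′≡X (columns-lower M X′ k))))
      (trans (cong (λ z → ι c * (ι X - ι X′) + (ι (columns M X) - z))
          (trans (ι-+ (columns M X′) (k ℕ.* c))
            (cong (ι (columns M X′) +_) (trans (ι-* k c) (cong (_* ι c) (ι-∸ X′≤X))))))
        (lemma (ι c) (ι X) (ι X′) (ι (columns M X)) (ι (columns M X′))))
      where
      c = column M X
      lemma : ∀ c x y a b → c * (x - y) + (a - (b + (x - y) * c)) ≡ a - b
      lemma = solve-∀ ring

    ι-columns-upper : ι (columns M X) - ι (columns M X′) ≤ ι (column M X′) * (ι X - ι X′)
    ι-columns-upper = ≤-difference (p≤q⇒0≤q-p (ι-mono-≤ (subst
        (λ Z → columns M Z ℕ.≤ columns M X′ ℕ.+ k ℕ.* c) k+X′≡X (columns-upper M X′ k))))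
      (trans (cong (λ z → ι (columns M X) - ι (columns M X′) + (z - ι (columns M X)))
          (trans (ι-+ (columns M X′) (k ℕ.* c))
            (cong (ι (columns M X′) +_) (trans (ι-* k c) (cong (_* ι c) (ι-∸ X′≤X))))))
        (lemma (ι c) (ι X) (ι X′) (ι (columns M X)) (ι (columns M X′))))
      where
      c = column M X′
      lemma : ∀ c x y a b → a - b + (b + (x - y) * c - a) ≡ c * (x - y)
      lemma = solve-∀ ring

  -- The points at the angles 2 arctan (i / N) of the circle of radius M are
  -- lattice points, because M is a multiple of all N² + i².
  module Rays (N-1 M-1 : ℕ)
    (divisible : ∀ i → i ℕ.≤ suc N-1 → suc N-1 ℕ.* suc N-1 ℕ.+ i ℕ.* i ℕ.∣ suc M-1) where

    N M : ℕ
    N = suc N-1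
    M = suc M-1

    -- The Pythagorean triple (N² - i², 2 N i, N² + i²), scaled by `e i` to hypotenuse `M`.
    d e X Y : ℕ → ℕ
    d i = N ℕ.* N ℕ.+ i ℕ.* i
    e i = M ℕ./ d i
    X i = (N ℕ.* N ℕ.∸ i ℕ.* i) ℕ.* e i
    Y i = 2 ℕ.* N ℕ.* i ℕ.* e i

    d*e≡M : ∀ {i} → i ℕ.≤ N → d i ℕ.* e i ≡ M
    d*e≡M {i} i≤N = ℕ.m*[n/m]≡n (divisible i i≤N)

    column-X : ∀ {i} → i ℕ.≤ N → column M (X i) ≡ Y i
    column-X {i} i≤N = column-≡ M (X i) (Y i) (begin
      X i ℕ.* X i ℕ.+ Y i ℕ.* Y i
        ≡⟨ cong (X i ℕ.* X i ℕ.+_) (lemma₁ N i (e i)) ⟩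
      X i ℕ.* X i ℕ.+ 4 ℕ.* (N ℕ.* N ℕ.* (i ℕ.* i)) ℕ.* (e i ℕ.* e i)
        ≡⟨ cong (λ n² → X i ℕ.* X i ℕ.+ 4 ℕ.* (n² ℕ.* (i ℕ.* i)) ℕ.* (e i ℕ.* e i)) A+i²≡N² ⟨
      X i ℕ.* X i ℕ.+ 4 ℕ.* ((A ℕ.+ i ℕ.* i) ℕ.* (i ℕ.* i)) ℕ.* (e i ℕ.* e i)
        ≡⟨ lemma₂ A (i ℕ.* i) (e i) ⟩
      (A ℕ.+ i ℕ.* i ℕ.+ i ℕ.* i) ℕ.* e i ℕ.* ((A ℕ.+ i ℕ.* i ℕ.+ i ℕ.* i) ℕ.* e i)
        ≡⟨ cong (λ n² → (n² ℕ.+ i ℕ.* i) ℕ.* e i ℕ.* ((n² ℕ.+ i ℕ.* i) ℕ.* e i)) A+i²≡N² ⟩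
      d i ℕ.* e i ℕ.* (d i ℕ.* e i)
        ≡⟨ cong (λ m → m ℕ.* m) (d*e≡M i≤N) ⟩
      M ℕ.* M ∎)
      where
      open ≡-Reasoning
      A = N ℕ.* N ℕ.∸ i ℕ.* i
      A+i²≡N² : A ℕ.+ i ℕ.* i ≡ N ℕ.* N
      A+i²≡N² = ℕ.m∸n+n≡m (ℕ.*-mono-≤ i≤N i≤N)
      lemma₁ : ∀ n i e → 2 ℕ.* n ℕ.* i ℕ.* e ℕ.* (2 ℕ.* n ℕ.* i ℕ.* e) ≡
        4 ℕ.* (n ℕ.* n ℕ.* (i ℕ.* i)) ℕ.* (e ℕ.* e)
      lemma₁ = ℕ-Solver.solve-∀
      lemma₂ : ∀ a b e → a ℕ.* e ℕ.* (a ℕ.* e) ℕ.+ 4 ℕ.* ((a ℕ.+ b) ℕ.* b) ℕ.* (e ℕ.* e) ≡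
        (a ℕ.+ b ℕ.+ b) ℕ.* e ℕ.* ((a ℕ.+ b ℕ.+ b) ℕ.* e)
      lemma₂ = ℕ-Solver.solve-∀

    X-antitone : ∀ i → X (suc i) ℕ.≤ X i
    X-antitone i = ℕ.*-mono-≤ (ℕ.∸-monoʳ-≤ (N ℕ.* N) i²≤)
      (ℕ./-monoʳ-≤ M (ℕ.+-monoʳ-≤ (N ℕ.* N) i²≤))
      where
      i²≤ : i ℕ.* i ℕ.≤ suc i ℕ.* suc i
      i²≤ = ℕ.*-mono-≤ (ℕ.n≤1+n i) (ℕ.n≤1+n i)

    h r : ℚ
    h = 1/suc N-1
    r = 1/suc M-1

    0≤h : 0ℚ ≤ h
    0≤h = 0≤/ 1 N

    0≤r : 0ℚ ≤ r
    0≤r = 0≤/ 1 M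

    hN≡1 : h * ι N ≡ 1ℚ
    hN≡1 = 1/suc-inverse N-1

    -- Lengths are in units of the radius. `u i` is N² / (N² + i²) = 1 / (1 + t²), because `e i` / M
    -- is 1 / `d i` for i ≤ N; `Φ i` is the area of the columns over [0, `x i`].
    t u x y Φ : ℕ → ℚ
    t i = ι i * h
    u i = ι N * ι N * ι (e i) * r
    x i = abscissa (t i) (u i)
    y i = halfOrdinate (t i) (u i)
    Φ i = r * r * ι (columns M (X i))

    0≤t : ∀ i → 0ℚ ≤ t i
    0≤t i = 0≤p*q (0≤ι i) 0≤h

    0≤u : ∀ i → 0ℚ ≤ u i
    0≤u i = 0≤p*q (0≤p*q (0≤p*q (0≤ι N) (0≤ι N)) (0≤ι (e i))) 0≤r

    t-suc : ∀ i → t (suc i) - t i ≡ h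
    t-suc i = trans (cong (λ z → z * h - t i) (ι-suc i)) (lemma (ι i) h)
      where
      lemma : ∀ i h → (1ℚ + i) * h - i * h ≡ h
      lemma = solve-∀ ring

    t-N : t N ≡ 1ℚ
    t-N = trans (ℚ.*-comm (ι N) h) hN≡1

    u-inverse : ∀ {i} → i ℕ.≤ N → u i * (1ℚ + t i * t i) ≡ 1ℚ
    u-inverse {i} i≤N = begin
      u i * (1ℚ + t i * t i)
        ≡⟨ lemma₁ (ι N) (ι i) (ι (e i)) h r ⟩
      r * ((ι N * ι N + ι i * ι i * ((h * ι N) * (h * ι N))) * ι (e i))
        ≡⟨ cong (λ z → r * ((ι N * ι N + ι i * ι i * (z * z)) * ι (e i))) hN≡1 ⟩
      r * ((ι N * ι N + ι i * ι i * (1ℚ * 1ℚ)) * ι (e i))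
        ≡⟨ lemma₂ (ι N) (ι i) (ι (e i)) r ⟩
      r * ((ι N * ι N + ι i * ι i) * ι (e i))
        ≡⟨ cong (λ z → r * (z * ι (e i))) (trans (ι-+ (N ℕ.* N) (i ℕ.* i)) (cong₂ _+_ (ι-* N N) (ι-* i i))) ⟨
      r * (ι (d i) * ι (e i))
        ≡⟨ cong (r *_) (ι-* (d i) (e i)) ⟨
      r * ι (d i ℕ.* e i)
        ≡⟨ cong (λ m → r * ι m) (d*e≡M i≤N) ⟩
      r * ι M
        ≡⟨ 1/suc-inverse M-1 ⟩
      1ℚ ∎
      where
      open ≡-Reasoning
      lemma₁ : ∀ N i e h r → N * N * e * r * (1ℚ + i * h * (i * h)) ≡
        r * ((N * N + i * i * ((h * N) * (h * N))) * e)
      lemma₁ = solve-∀ ring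
      lemma₂ : ∀ N i e r → r * ((N * N + i * i * (1ℚ * 1ℚ)) * e) ≡ r * ((N * N + i * i) * e)
      lemma₂ = solve-∀ ring

    x-≡ : ∀ {i} → i ℕ.≤ N → x i ≡ r * ι (X i)
    x-≡ {i} i≤N = begin
      x i
        ≡⟨ lemma₁ (ι N) (ι i) (ι (e i)) h r ⟩
      r * ((ι N * ι N - ι i * ι i * ((h * ι N) * (h * ι N))) * ι (e i))
        ≡⟨ cong (λ z → r * ((ι N * ι N - ι i * ι i * (z * z)) * ι (e i))) hN≡1 ⟩
      r * ((ι N * ι N - ι i * ι i * (1ℚ * 1ℚ)) * ι (e i))
        ≡⟨ lemma₂ (ι N) (ι i) (ι (e i)) r ⟩
      r * ((ι N * ι N - ι i * ι i) * ι (e i))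
        ≡⟨ cong (λ z → r * (z * ι (e i))) (trans (ι-∸ (ℕ.*-mono-≤ i≤N i≤N)) (cong₂ _-_ (ι-* N N) (ι-* i i))) ⟨
      r * (ι (N ℕ.* N ℕ.∸ i ℕ.* i) * ι (e i))
        ≡⟨ cong (r *_) (ι-* (N ℕ.* N ℕ.∸ i ℕ.* i) (e i)) ⟨
      r * ι (X i) ∎
      where
      open ≡-Reasoning
      lemma₁ : ∀ N i e h r → (1ℚ - i * h * (i * h)) * (N * N * e * r) ≡
        r * ((N * N - i * i * ((h * N) * (h * N))) * e)
      lemma₁ = solve-∀ ring
      lemma₂ : ∀ N i e r → r * ((N * N - i * i * (1ℚ * 1ℚ)) * e) ≡ r * ((N * N - i * i) * e)
      lemma₂ = solve-∀ ring

    2y-≡ : ∀ i → 2ℚ * y i ≡ r * ι (Y i)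
    2y-≡ i = begin
      2ℚ * y i
        ≡⟨ lemma (ι N) (ι i) (ι (e i)) h r ⟩
      r * (2ℚ * ι N * ι i * ι (e i)) * (h * ι N)
        ≡⟨ trans (cong (r * (2ℚ * ι N * ι i * ι (e i)) *_) hN≡1) (ℚ.*-identityʳ _) ⟩
      r * (2ℚ * ι N * ι i * ι (e i))
        ≡⟨ cong (λ z → r * (z * ι i * ι (e i))) (ι-* 2 N) ⟨
      r * (ι (2 ℕ.* N) * ι i * ι (e i))
        ≡⟨ cong (λ z → r * (z * ι (e i))) (ι-* (2 ℕ.* N) i) ⟨
      r * (ι (2 ℕ.* N ℕ.* i) * ι (e i))
        ≡⟨ cong (r *_) (ι-* (2 ℕ.* N ℕ.* i) (e i)) ⟨
      r * ι (Y i) ∎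
      where
      open ≡-Reasoning
      lemma : ∀ N i e h r → (1ℚ + 1ℚ) * (i * h * (N * N * e * r)) ≡
        r * ((1ℚ + 1ℚ) * N * i * e) * (h * N)
      lemma = solve-∀ ring

    private
      scale : ∀ {i j} → i ℕ.≤ N → suc j ℕ.≤ N →
        2ℚ * y i * (x j - x (suc j)) ≡ r * r * (ι (column M (X i)) * (ι (X j) - ι (X (suc j))))
      scale {i} {j} i≤N j<N = trans
        (cong₂ _*_ (2y-≡ i) (cong₂ _-_ (x-≡ (ℕ.<⇒≤ j<N)) (x-≡ j<N)))
        (trans (cong (λ c → r * ι c * (r * ι (X j) - r * ι (X (suc j)))) (sym (column-X i≤N)))
          (lemma r (ι (column M (X i))) (ι (X j)) (ι (X (suc j)))))
        where
        lemma : ∀ r c a b → r * c * (r * a - r * b) ≡ r * r * (c * (a - b))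
        lemma = solve-∀ ring

    Φ-lower : ∀ {i} → i ℕ.< N → 2ℚ * y i * (x i - x (suc i)) ≤ Φ i - Φ (suc i)
    Φ-lower {i} i<N = subst₂ _≤_ (sym (scale (ℕ.<⇒≤ i<N) i<N))
      (*-distribˡ-- (r * r) (ι (columns M (X i))) (ι (columns M (X (suc i)))))
      (*-monoˡ-≤ (0≤p*q 0≤r 0≤r) (ι-columns-lower M (X-antitone i)))

    Φ-upper : ∀ {i} → i ℕ.< N → Φ i - Φ (suc i) ≤ 2ℚ * y (suc i) * (x i - x (suc i))
    Φ-upper {i} i<N = subst₂ _≤_
      (*-distribˡ-- (r * r) (ι (columns M (X i))) (ι (columns M (X (suc i)))))
      (sym (scale i<N i<N))
      (*-monoˡ-≤ (0≤p*q 0≤r 0≤r) (ι-columns-upper M (X-antitone i)))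

    t-mono : ∀ {i j} → i ℕ.≤ j → t i ≤ t j
    t-mono {i} i≤j = *-mono-≤ (0≤ι i) 0≤h (ι-mono-≤ i≤j) ℚ.≤-refl

    module _ (J : ℕ) where

      -- The triangle below the i-th radius has area `x i * y i`, so `Φ i - x i * y i` is about the
      -- sector from that radius to the vertical axis, of area π / 4 - arctan (`t i`). Adding
      -- `arctan J (t i)` gives a nearly constant quantity that passes from the lattice count at 0
      -- to the Leibniz sum at N. In `error`, the sign of `h * u i` is negative because u decreases.
      value error : ℕ → ℚ
      value i = Φ i - x i * y i + arctan J (t i)
      error i = 4ℚ * h * y i - h * u i + h * evenPowers J (t i) + monomial (2 ℕ.* J) (t i)

      value-step : ∀ i → i ℕ.< N → value (suc i) ≈ value i ± (error (suc i) - error i)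
      value-step i i<N = ≈-sym (subst₂ (_≈_± (error (suc i) - error i))
        (lemma₁ (Φ i) (Φ (suc i)) (x i * y i) (x (suc i) * y (suc i)) (arctan J (t i)))
        (lemma₂ (Φ (suc i)) (x (suc i) * y (suc i)) (arctan J (t i)) (arctan J (t (suc i))))
        (subst (Δ - (x i * y i - x (suc i) * y (suc i)) + c ≈ arctan J (t (suc i)) - arctan J (t i) + c ±_)
          (lemma₃ h (y i) (y (suc i)) (u i) (u (suc i))
            (evenPowers J (t i)) (evenPowers J (t (suc i)))
            (monomial (2 ℕ.* J) (t i)) (monomial (2 ℕ.* J) (t (suc i))))
          (≈-+ (≈-trans sector (≈-sym series)) (≈-refl {c} refl))))
        where
        Δ = Φ i - Φ (suc i)
        -- Added to both increments, each close to `h * u i`, this turns them into `value i` and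
        -- `value (suc i)`.
        c = Φ (suc i) - x (suc i) * y (suc i) + arctan J (t i)
        i≤N = ℕ.<⇒≤ i<N
        t≤t′ = t-mono (ℕ.n≤1+n i)
        sector : Δ - (x i * y i - x (suc i) * y (suc i)) ≈ h * u i ±
          (4ℚ * h * (y (suc i) - y i) + h * (u i - u (suc i)))
        sector = subst
          (λ h → Δ - (x i * y i - x (suc i) * y (suc i)) ≈ h * u i ±
            (4ℚ * h * (y (suc i) - y i) + h * (u i - u (suc i))))
          (t-suc i)
          (Sector.sector-≈ (0≤t i) t≤t′ (subst (t (suc i) ≤_) t-N (t-mono i<N))
            (0≤u i) (0≤u (suc i)) (u-inverse i≤N) (u-inverse i<N) (Φ-lower i<N) (Φ-upper i<N))
        series : arctan J (t (suc i)) - arctan J (t i) ≈ h * u i ±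
          (h * (evenPowers J (t (suc i)) - evenPowers J (t i)) +
            (monomial (2 ℕ.* J) (t (suc i)) - monomial (2 ℕ.* J) (t i)))
        series = subst
          (λ h → arctan J (t (suc i)) - arctan J (t i) ≈ h * u i ±
            (h * (evenPowers J (t (suc i)) - evenPowers J (t i)) +
              (monomial (2 ℕ.* J) (t (suc i)) - monomial (2 ℕ.* J) (t i))))
          (t-suc i)
          (arctan-step J (0≤t i) t≤t′ (0≤u i) (u-inverse i≤N))
        lemma₁ : ∀ a b p q g → a - b - (p - q) + (b - q + g) ≡ a - p + g
        lemma₁ = solve-∀ ring
        lemma₂ : ∀ b q g g′ → g′ - g + (b - q + g) ≡ b - q + g′
        lemma₂ = solve-∀ ring
        lemma₃ : ∀ h y y′ u u′ p p′ m m′ →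
          (1ℚ + 1ℚ + (1ℚ + 1ℚ)) * h * (y′ - y) + h * (u - u′) + (h * (p′ - p) + (m′ - m)) + 0ℚ ≡
          (1ℚ + 1ℚ + (1ℚ + 1ℚ)) * h * y′ - h * u′ + h * p′ + m′ -
            ((1ℚ + 1ℚ + (1ℚ + 1ℚ)) * h * y - h * u + h * p + m)
        lemma₃ = solve-∀ ring

      t-0 : t 0 ≡ 0ℚ
      t-0 = ℚ.*-zeroˡ h

      value-0 : value 0 ≡ r * r * ι (quarterDisc M)
      value-0 = begin
        Φ 0 - x 0 * y 0 + arctan J (t 0)
          ≡⟨ cong₂ (λ t g → Φ 0 - x 0 * (t * u 0) + g) t-0 (trans (cong (arctan J) t-0) (arctan-0 J)) ⟩
        Φ 0 - x 0 * (0ℚ * u 0) + 0ℚ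
          ≡⟨ lemma (Φ 0) (x 0) (u 0) ⟩
        Φ 0
          ≡⟨ cong (λ m → r * r * ι (columns M m)) X-0 ⟩
        r * r * ι (quarterDisc M) ∎
        where
        open ≡-Reasoning
        lemma : ∀ a b c → a - b * (0ℚ * c) + 0ℚ ≡ a
        lemma = solve-∀ ring
        X-0 : X 0 ≡ M
        X-0 = trans (cong (ℕ._* e 0) (sym (ℕ.+-identityʳ (N ℕ.* N)))) (d*e≡M z≤n)

      value-N : value N ≡ leibniz J
      value-N = begin
        Φ N - x N * y N + arctan J (t N)
          ≡⟨ cong₂ (λ m g → r * r * ι (columns M m) - x N * y N + g) X-N
               (trans (cong (arctan J) t-N) (arctan-1 J)) ⟩
        r * r * 0ℚ - x N * y N + leibniz J
          ≡⟨ cong (λ z → r * r * 0ℚ - z * y N + leibniz J)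
               (trans (x-≡ ℕ.≤-refl) (trans (cong (λ m → r * ι m) X-N) (ℚ.*-zeroʳ r))) ⟩
        r * r * 0ℚ - 0ℚ * y N + leibniz J
          ≡⟨ lemma r (y N) (leibniz J) ⟩
        leibniz J ∎
        where
        open ≡-Reasoning
        lemma : ∀ r y l → r * r * 0ℚ - 0ℚ * y + l ≡ l
        lemma = solve-∀ ring
        X-N : X N ≡ 0
        X-N = cong (ℕ._* e N) (ℕ.n∸n≡0 (N ℕ.* N))

      -- The 5 is 4 from `y N` ≤ 1 plus 1 from `u 0` ≤ 1, and `evenPowers J` at 1 is J. The other
      -- terms only decrease the difference and go into `slack`.
      error-bound : error N - error 0 ≤ ι (5 ℕ.+ J) * h + 1/suc (2 ℕ.* J)
      error-bound = ≤-difference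
        (0≤p+q (0≤p+q (0≤p*q (0≤p*q (0≤p+q 0≤2 0≤2) 0≤h) (p≤q⇒0≤q-p y-N≤1))
            (0≤p*q 0≤h (p≤q⇒0≤q-p (u≤1 (0≤t 0) (0≤u 0) (u-inverse z≤n)))))
          (0≤p+q (0≤p+q (0≤p*q (0≤p*q (0≤p+q 0≤2 0≤2) 0≤h) (0≤p*q (0≤t 0) (0≤u 0)))
              (0≤p*q 0≤h (0≤u N)))
            (0≤p+q (0≤p*q 0≤h 0≤E₀) (0≤p*q (0≤/ 1 (suc (2 ℕ.* J))) (0≤pow (suc (2 ℕ.* J)) (0≤t 0))))))
        (trans (cong₂ (λ E m → 4ℚ * h * y N - h * u N + h * E + m - error 0 + slack)
            (trans (cong (evenPowers J) t-N) E₁) (trans (cong (monomial (2 ℕ.* J)) t-N) m₁))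
          (trans (lemma h (y N) (y 0) (u N) (u 0) (ι J) (evenPowers J (t 0))
              (1/suc (2 ℕ.* J)) (monomial (2 ℕ.* J) (t 0)))
            (cong (λ z → z * h + 1/suc (2 ℕ.* J)) (sym (ι-+ 5 J)))))
        where
        0≤2 : 0ℚ ≤ 2ℚ
        0≤2 = 0≤p+q 0≤1 0≤1
        slack = 4ℚ * h * (1ℚ - y N) + h * (1ℚ - u 0) +
          (4ℚ * h * y 0 + h * u N + (h * evenPowers J (t 0) + monomial (2 ℕ.* J) (t 0)))
        y-N≤1 : y N ≤ 1ℚ
        y-N≤1 = subst (_≤ 1ℚ) (sym (trans (cong (_* u N) t-N) (ℚ.*-identityˡ _)))
          (u≤1 (0≤t N) (0≤u N) (u-inverse ℕ.≤-refl))
        0≤E₀ : 0ℚ ≤ evenPowers J (t 0)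
        0≤E₀ = subst (_≤ evenPowers J (t 0)) (∑-0 J) (∑-mono-≤ J λ j → 0≤pow (2 ℕ.* j) (0≤t 0))
        E₁ : evenPowers J 1ℚ ≡ ι J
        E₁ = trans (∑-cong J λ j → pow-1 (2 ℕ.* j)) (∑-1 J)
        m₁ : monomial (2 ℕ.* J) 1ℚ ≡ 1/suc (2 ℕ.* J)
        m₁ = trans (cong (1/suc (2 ℕ.* J) *_) (pow-1 (suc (2 ℕ.* J)))) (ℚ.*-identityʳ _)
        lemma : ∀ h y′ y u′ u J E c m →
          (1ℚ + 1ℚ + (1ℚ + 1ℚ)) * h * y′ - h * u′ + h * J + c -
            ((1ℚ + 1ℚ + (1ℚ + 1ℚ)) * h * y - h * u + h * E + m) +
          ((1ℚ + 1ℚ + (1ℚ + 1ℚ)) * h * (1ℚ - y′) + h * (1ℚ - u) +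
            ((1ℚ + 1ℚ + (1ℚ + 1ℚ)) * h * y + h * u′ + (h * E + m))) ≡
          (1ℚ + 1ℚ + 1ℚ + 1ℚ + 1ℚ + J) * h + c
        lemma = solve-∀ ring

      quarterDisc-≈-leibniz :
        r * r * ι (quarterDisc M) ≈ leibniz J ± (ι (5 ℕ.+ J) * h + 1/suc (2 ℕ.* J))
      quarterDisc-≈-leibniz = ≈-weaken error-bound (≈-sym
        (subst₂ (_≈_± (error N - error 0)) value-N value-0 (≈-telescope value error N value-step)))

  -- Limits

  0<1/suc : ∀ n → 0ℚ < 1/suc n
  0<1/suc n = ℚ.positive⁻¹ (1/suc n) {{ℚ.normalize-pos 1 (suc n)}}

  -- With d + 1 the denominator of ε, 1 / (d + 1) ≤ ε by positivity, and c / (c (d + 1) + 1) ≤ 1 /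
  -- (d + 1).
  archimedean : ∀ c ε → 0ℚ < ε → ∃[ q ] ι c * 1/suc q ≤ ε
  archimedean c (mkℚ (ℤ.+ zero) _ _)  (*<* (ℤ.+<+ ()))
  archimedean c (mkℚ ℤ.-[1+ _ ] _ _)  (*<* ())
  archimedean c ε@(mkℚ (ℤ.+ suc p) d _) _ = q , ℚ.≤-trans
    (≤-difference (0≤p*q (0≤/ 1 (suc d)) (0≤/ 1 (suc q))) (begin
      ι c * w + e * w                                        ≡⟨ lemma₁ (ι c) w e ⟩
      w * (e * 1ℚ + ι c * 1ℚ)                                ≡⟨ cong (λ z → w * (e * 1ℚ + ι c * z)) (1/suc-inverse d) ⟨
      w * (e * 1ℚ + ι c * (e * ι (suc d)))                   ≡⟨ lemma₂ (ι c) w e (ι (suc d)) ⟩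
      e * (w * (1ℚ + ι c * ι (suc d)))                       ≡⟨ cong (λ z → e * (w * z)) (trans (ι-suc (c ℕ.* suc d)) (cong (1ℚ +_) (ι-* c (suc d)))) ⟨
      e * (w * ι (suc q))                                    ≡⟨ cong (e *_) (1/suc-inverse q) ⟩
      e * 1ℚ                                                 ≡⟨ ℚ.*-identityʳ e ⟩
      e ∎))
    e≤ε
    where
    open ≡-Reasoning
    q = c ℕ.* suc d
    e = 1/suc d
    w = 1/suc q
    e≤ε : e ≤ ε
    e≤ε = ℚ.toℚᵘ-cancel-≤ (ℚᵘ.≤-respˡ-≃ (ℚᵘ.≃-sym {toℚᵘ e} (toℚᵘ-/ 1 d))
      (ℚᵘ.*≤* (ℤ.*-monoʳ-≤-nonNeg (ℤ.+ suc d) (ℤ.+≤+ {n = suc p} (s≤s z≤n)))))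
    lemma₁ : ∀ c w e → c * w + e * w ≡ w * (e * 1ℚ + c * 1ℚ)
    lemma₁ = solve-∀ ring
    lemma₂ : ∀ c w e d → w * (e * 1ℚ + c * (e * d)) ≡ e * (w * (1ℚ + c * d))
    lemma₂ = solve-∀ ring

  seq-π : ∀ k → seq π k ≡ 4ℚ * (1/suc k * 1/suc k * ι (quarterDisc (suc k)))
  seq-π k = begin
    p                                       ≡⟨ lemma₁ p ⟩
    p * (1ℚ * 1ℚ)                           ≡⟨ cong (λ z → p * (z * z)) (1/suc-inverse k) ⟨
    p * ((r * ι M) * (r * ι M))             ≡⟨ lemma₂ p r (ι M) ⟩
    r * r * (p * (ι M * ι M))               ≡⟨ cong (λ z → r * r * (p * z)) (ι-* M M) ⟨
    r * r * (p * ι (M ℕ.* M))               ≡⟨ cong (r * r *_) (/-*-cancel (4 ℕ.* quarterDisc M) (M ℕ.* M)) ⟩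
    r * r * ι (4 ℕ.* quarterDisc M)         ≡⟨ cong (r * r *_) (ι-* 4 (quarterDisc M)) ⟩
    r * r * (4ℚ * ι (quarterDisc M))        ≡⟨ lemma₃ (r * r) 4ℚ (ι (quarterDisc M)) ⟩
    4ℚ * (r * r * ι (quarterDisc M)) ∎
    where
    open ≡-Reasoning
    M = suc k
    p = seq π k
    r = 1/suc k
    lemma₁ : ∀ p → p ≡ p * (1ℚ * 1ℚ)
    lemma₁ = solve-∀ ring
    lemma₂ : ∀ p r m → p * ((r * m) * (r * m)) ≡ r * r * (p * (m * m))
    lemma₂ = solve-∀ ring
    lemma₃ : ∀ a b c → a * (b * c) ≡ b * (a * c)
    lemma₃ = solve-∀ ring

  d∣n! : ∀ d n .{{_ : NonZero d}} → d ℕ.≤ n → d ℕ.∣ n !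
  d∣n! (suc d) n d≤n = ℕ.∣-trans (ℕ.m∣m*n (d !)) (ℕ.m≤n⇒m!∣n! d≤n)

  -- One suitable radius beyond the Cauchy threshold controls all later terms of `π`. Of 5η ≤ ε, one
  -- η is the Cauchy distance and four come from 4 (5 + J) / N.
  π-≈-leibniz : ∀ J ε → 0ℚ < ε → ∃[ K ] ∀ k → K ℕ.≤ k →
    seq π k ≈ 4ℚ * leibniz J ± (ε + 4ℚ * 1/suc (2 ℕ.* J))
  π-≈-leibniz J ε 0<ε = K , λ k K≤k → ≈-weaken
    (≤-difference (p≤q⇒0≤q-p 5η≤ε) (lemma η (4ℚ * 1/suc (2 ℕ.* J)) ε (1/suc (2 ℕ.* J))))
    (≈-trans (∣-∣≤⇒≈ (ℚ.<⇒≤ (close k m K≤k K≤m)))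
      (subst₂ (λ p e → p ≈ 4ℚ * leibniz J ± 4ℚ * (e + 1/suc (2 ℕ.* J)))
        (sym (seq-π m)) h≡η
        (≈-* 4ℚ (ℚ.nonNegative⁻¹ 4ℚ) (Rays.quarterDisc-≈-leibniz N-1 m divisible J))))
    where
    q = proj₁ (archimedean 5 ε 0<ε)
    5η≤ε = proj₂ (archimedean 5 ε 0<ε)
    η = 1/suc q
    K = proj₁ (cauchy π η (0<1/suc q))
    close = proj₂ (cauchy π η (0<1/suc q))
    -- Chosen so that N is (5 + J)(q + 1) by computation, whence (5 + J) / N = η.
    N-1 = q ℕ.+ (4 ℕ.+ J) ℕ.* suc q
    N = suc N-1
    -- Every N² + i² with i ≤ N is at most 2N² and hence divides this factorial.
    D = (N ℕ.* N ℕ.+ N ℕ.* N) !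
    instance
      D≢0 : NonZero D
      D≢0 = (N ℕ.* N ℕ.+ N ℕ.* N) ℕ.!≢0
      DK≢0 : NonZero (D ℕ.* suc K)
      DK≢0 = ℕ.m*n≢0 D (suc K)
    -- The factor K + 1 pushes the index past K and preserves divisibility; the term of index m
    -- belongs to the radius m + 1.
    m = ℕ.pred (D ℕ.* suc K)
    K≤m : K ℕ.≤ m
    K≤m = ℕ.pred-mono-≤ (ℕ.m≤n*m (suc K) D)
    divisible : ∀ i → i ℕ.≤ N → N ℕ.* N ℕ.+ i ℕ.* i ℕ.∣ suc m
    divisible i i≤N = subst (N ℕ.* N ℕ.+ i ℕ.* i ℕ.∣_) (sym (ℕ.suc-pred (D ℕ.* suc K)))
      (ℕ.∣m⇒∣m*n (suc K) (d∣n! (N ℕ.* N ℕ.+ i ℕ.* i) _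
        (ℕ.+-monoʳ-≤ (N ℕ.* N) (ℕ.*-mono-≤ i≤N i≤N))))
    h≡η : ι (5 ℕ.+ J) * 1/suc N-1 ≡ η
    h≡η = begin
      ι (5 ℕ.+ J) * 1/suc N-1                       ≡⟨ lemma₁ (ι (5 ℕ.+ J)) (1/suc N-1) ⟩
      1/suc N-1 * ι (5 ℕ.+ J) * 1ℚ                  ≡⟨ cong (1/suc N-1 * ι (5 ℕ.+ J) *_) (1/suc-inverse q) ⟨
      1/suc N-1 * ι (5 ℕ.+ J) * (η * ι (suc q))     ≡⟨ lemma₂ (1/suc N-1) (ι (5 ℕ.+ J)) η (ι (suc q)) ⟩
      η * (1/suc N-1 * (ι (5 ℕ.+ J) * ι (suc q)))   ≡⟨ cong (λ z → η * (1/suc N-1 * z)) (ι-* (5 ℕ.+ J) (suc q)) ⟨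
      η * (1/suc N-1 * ι N)                         ≡⟨ cong (η *_) (1/suc-inverse N-1) ⟩
      η * 1ℚ                                        ≡⟨ ℚ.*-identityʳ η ⟩
      η ∎
      where
      open ≡-Reasoning
      lemma₁ : ∀ a b → a * b ≡ b * a * 1ℚ
      lemma₁ = solve-∀ ring
      lemma₂ : ∀ a b c d → a * b * (c * d) ≡ c * (a * (b * d))
      lemma₂ = solve-∀ ring
    lemma : ∀ η c′ ε c → η + (1ℚ + 1ℚ + (1ℚ + 1ℚ)) * (η + c) + (ε - (1ℚ + 1ℚ + 1ℚ + 1ℚ + 1ℚ) * η) ≡
      ε + (1ℚ + 1ℚ + (1ℚ + 1ℚ)) * c
    lemma = solve-∀ ring

  -- With s = `⌊√ n ⌋`, n ≤ s² + 2s gives 2n ≤ 2s² + 4s < (3s + 1)².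
  ⌊√2n⌋≤3⌊√n⌋ : ∀ n → ⌊√ 2 ℕ.* n ⌋ ℕ.≤ 3 ℕ.* ⌊√ n ⌋
  ⌊√2n⌋≤3⌊√n⌋ n = ℕ.s≤s⁻¹ (square-cancel-< (begin-strict
    ⌊√ 2 ℕ.* n ⌋ ℕ.* ⌊√ 2 ℕ.* n ⌋             ≤⟨ ⌊√⌋-lower (2 ℕ.* n) ⟩
    2 ℕ.* n                                   ≤⟨ ℕ.*-monoʳ-≤ 2 (ℕ.s≤s⁻¹ (⌊√⌋-upper n)) ⟩
    2 ℕ.* (s ℕ.+ s ℕ.* suc s)                 <⟨ s≤s (ℕ.m≤m+n _ (7 ℕ.* (s ℕ.* s) ℕ.+ 2 ℕ.* s)) ⟩
    suc (2 ℕ.* (s ℕ.+ s ℕ.* suc s) ℕ.+ (7 ℕ.* (s ℕ.* s) ℕ.+ 2 ℕ.* s)) ≡⟨ lemma s ⟩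
    suc (3 ℕ.* s) ℕ.* suc (3 ℕ.* s) ∎))
    where
    open ℕ.≤-Reasoning
    s = ⌊√ n ⌋
    lemma : ∀ s → 1 ℕ.+ (2 ℕ.* (s ℕ.+ s ℕ.* (1 ℕ.+ s)) ℕ.+ (7 ℕ.* (s ℕ.* s) ℕ.+ 2 ℕ.* s)) ≡
      (1 ℕ.+ 3 ℕ.* s) ℕ.* (1 ℕ.+ 3 ℕ.* s)
    lemma = ℕ-Solver.solve-∀

  -- The Leibniz remainder after magnification by 2n; it is of order J because (J + 1)² ≤ 2J (2J +
  -- 1) for J ≥ 1.
  2n*1/suc2J≤2J : ∀ n J .{{_ : NonZero J}} → 2 ℕ.* n ℕ.< suc J ℕ.* suc J →
    ι (2 ℕ.* n) * 1/suc (2 ℕ.* J) ≤ ι (2 ℕ.* J)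
  2n*1/suc2J≤2J n J@(suc j) 2n< = begin
    ι (2 ℕ.* n) * c                        ≤⟨ *-mono-≤ (0≤ι (2 ℕ.* n)) (0≤/ 1 (suc (2 ℕ.* J))) (ι-mono-≤ 2n≤) ℚ.≤-refl ⟩
    ι (2 ℕ.* J ℕ.* suc (2 ℕ.* J)) * c      ≡⟨ cong (_* c) (ι-* (2 ℕ.* J) (suc (2 ℕ.* J))) ⟩
    ι (2 ℕ.* J) * ι (suc (2 ℕ.* J)) * c    ≡⟨ lemma (ι (2 ℕ.* J)) (ι (suc (2 ℕ.* J))) c ⟩
    c * ι (suc (2 ℕ.* J)) * ι (2 ℕ.* J)    ≡⟨ cong (_* ι (2 ℕ.* J)) (1/suc-inverse (2 ℕ.* J)) ⟩
    1ℚ * ι (2 ℕ.* J)                       ≡⟨ ℚ.*-identityˡ _ ⟩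
    ι (2 ℕ.* J) ∎
    where
    open ℚ.≤-Reasoning
    c = 1/suc (2 ℕ.* J)
    lemma : ∀ a b c → a * b * c ≡ c * b * a
    lemma = solve-∀ ring
    expand : ∀ j → 2 ℕ.* (1 ℕ.+ j) ℕ.* (1 ℕ.+ 2 ℕ.* (1 ℕ.+ j)) ≡
      (2 ℕ.+ j) ℕ.* (2 ℕ.+ j) ℕ.+ (2 ℕ.+ 6 ℕ.* j ℕ.+ 3 ℕ.* (j ℕ.* j))
    expand = ℕ-Solver.solve-∀
    2n≤ : 2 ℕ.* n ℕ.≤ 2 ℕ.* J ℕ.* suc (2 ℕ.* J)
    2n≤ = ℕ.≤-trans (ℕ.<⇒≤ 2n<)
      (ℕ.≤-trans (ℕ.m≤m+n _ _) (ℕ.≤-reflexive (sym (expand j))))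

  -- The losses are 2J from the count and at most 2J from the Leibniz remainder, and 4J ≤ 12
  -- `⌊√ n ⌋`. The ε pays only for replacing π by a late term of its sequence.
  𝓡-≈-π : ∀ n .{{_ : NonZero n}} ε → 0ℚ < ε → ∃[ K ] ∀ k → K ℕ.≤ k →
    ι (𝓡 n) ≈ (seq π k * ½ - ι 1) * ι n ± (ι 12 * ι ⌊√ n ⌋ + ε)
  𝓡-≈-π n ε 0<ε = proj₁ limit , λ k K≤k → ≈-weaken total (≈-trans
    (𝓡-≈-leibniz n J (⌊√⌋-upper (2 ℕ.* n)))
    (≈-sym (subst₂ (λ p l → p ≈ l ± (½ * ι n * (η + 4ℚ * c) + 0ℚ))
      (lemma₁ ½ (ι n) (seq π k))
      main
      (≈-- (≈-* (½ * ι n) (0≤p*q (ℚ.nonNegative⁻¹ ½) (0≤ι n)) (proj₂ limit k K≤k))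
        (≈-refl {ι n} refl)))))
    where
    J = ⌊√ 2 ℕ.* n ⌋
    instance
      J≢0 : NonZero J
      J≢0 = ℕ.>-nonZero (⌊√⌋-greatest (ℕ.≤-trans (ℕ.>-nonZero⁻¹ n) (ℕ.m≤m+n n _)))
    q = proj₁ (archimedean n ε 0<ε)
    nη≤ε = proj₂ (archimedean n ε 0<ε)
    η = 1/suc q
    c = 1/suc (2 ℕ.* J)
    limit = π-≈-leibniz J η (0<1/suc q)
    lemma₁ : ∀ h n p → h * n * p - n ≡ (p * h - 1ℚ) * n
    lemma₁ = solve-∀ ring
    lemma₂ : ∀ h n f l → h * n * (f * l) ≡ (h * f) * n * l
    lemma₂ = solve-∀ ring
    double : ½ * 4ℚ * ι n ≡ ι (2 ℕ.* n)
    double = sym (ι-* 2 n)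
    main : ½ * ι n * (4ℚ * leibniz J) - ι n ≡ ι (2 ℕ.* n) * leibniz J - ι n
    main = cong (_- ι n) (trans (lemma₂ ½ (ι n) 4ℚ (leibniz J)) (cong (_* leibniz J) double))
    total : ι J + ι J + (½ * ι n * (η + 4ℚ * c) + 0ℚ) ≤ ι 12 * ι ⌊√ n ⌋ + ε
    total = begin
      ι J + ι J + (½ * ι n * (η + 4ℚ * c) + 0ℚ)
        ≡⟨ lemma₃ ½ (ι n) η 4ℚ c (ι J) ⟩
      (1ℚ + 1ℚ) * ι J + ½ * 4ℚ * ι n * c + ½ * (ι n * η)
        ≡⟨ cong₂ (λ a b → a + b * c + ½ * (ι n * η)) (sym (ι-* 2 J)) double ⟩
      ι (2 ℕ.* J) + ι (2 ℕ.* n) * c + ½ * (ι n * η)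
        ≤⟨ ℚ.+-mono-≤ (ℚ.+-monoʳ-≤ (ι (2 ℕ.* J)) (2n*1/suc2J≤2J n J (⌊√⌋-upper (2 ℕ.* n))))
             (*-mono-≤ (ℚ.nonNegative⁻¹ ½) (0≤p*q (0≤ι n) (0≤/ 1 (suc q))) ½≤1 nη≤ε) ⟩
      ι (2 ℕ.* J) + ι (2 ℕ.* J) + 1ℚ * ε
        ≡⟨ cong₂ _+_ (sym (ι-+ (2 ℕ.* J) (2 ℕ.* J))) (ℚ.*-identityˡ ε) ⟩
      ι (2 ℕ.* J ℕ.+ 2 ℕ.* J) + ε
        ≤⟨ ℚ.+-monoˡ-≤ ε (ι-mono-≤ 4J≤12s) ⟩
      ι (12 ℕ.* ⌊√ n ⌋) + ε
        ≡⟨ cong (_+ ε) (ι-* 12 ⌊√ n ⌋) ⟩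
      ι 12 * ι ⌊√ n ⌋ + ε ∎
      where
      open ℚ.≤-Reasoning
      ½≤1 : ½ ≤ 1ℚ
      ½≤1 = ≤-difference (ℚ.nonNegative⁻¹ ½) refl
      lemma₃ : ∀ h n η f c J → J + J + (h * n * (η + f * c) + 0ℚ) ≡
        (1ℚ + 1ℚ) * J + h * f * n * c + h * (n * η)
      lemma₃ = solve-∀ ring
      4J≤12s : 2 ℕ.* J ℕ.+ 2 ℕ.* J ℕ.≤ 12 ℕ.* ⌊√ n ⌋
      4J≤12s = subst₂ ℕ._≤_ (lemma₄ J) (lemma₅ ⌊√ n ⌋) (ℕ.*-monoʳ-≤ 4 (⌊√2n⌋≤3⌊√n⌋ n))
        where
        lemma₄ : ∀ j → 4 ℕ.* j ≡ 2 ℕ.* j ℕ.+ 2 ℕ.* j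
        lemma₄ = ℕ-Solver.solve-∀
        lemma₅ : ∀ s → 4 ℕ.* (3 ℕ.* s) ≡ 12 ℕ.* s
        lemma₅ = ℕ-Solver.solve-∀

  -- True of every term and not only in the limit: the square of `⌊√ n ⌋` (k + 1) is at most n (k +
  -- 1)².
  ⌊√⌋≤√ : ∀ n k → ι ⌊√ n ⌋ ≤ seq (√ n) k
  ⌊√⌋≤√ n k = ℚ.*-cancelʳ-≤-pos (ι (suc k)) {{ι-pos (suc k)}} (begin
    ι ⌊√ n ⌋ * ι (suc k)                       ≡⟨ ι-* ⌊√ n ⌋ (suc k) ⟨
    ι (⌊√ n ⌋ ℕ.* suc k)                       ≤⟨ ι-mono-≤ {⌊√ n ⌋ ℕ.* suc k} (⌊√⌋-greatest bound) ⟩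
    ι ⌊√ n ℕ.* (suc k ℕ.* suc k) ⌋             ≡⟨ /-*-cancel ⌊√ n ℕ.* (suc k ℕ.* suc k) ⌋ (suc k) ⟨
    seq (√ n) k * ι (suc k) ∎)
    where
    open ℚ.≤-Reasoning
    lemma : ∀ s k → s ℕ.* k ℕ.* (s ℕ.* k) ≡ s ℕ.* s ℕ.* (k ℕ.* k)
    lemma = ℕ-Solver.solve-∀
    bound : ⌊√ n ⌋ ℕ.* suc k ℕ.* (⌊√ n ⌋ ℕ.* suc k) ℕ.≤ n ℕ.* (suc k ℕ.* suc k)
    bound = ℕ.≤-trans (ℕ.≤-reflexive (lemma ⌊√ n ⌋ (suc k)))
      (ℕ.*-monoˡ-≤ (suc k ℕ.* suc k) (⌊√⌋-lower n))

  -- Both `⌊√ n ⌋` and q + 1 have squares at most n, so their product is at most n.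
  ⌊√⌋/n≤1/suc : ∀ n q .{{_ : NonZero n}} → suc q ℕ.* suc q ℕ.≤ n →
    (ℤ.+ 1 / n) * ι ⌊√ n ⌋ ≤ 1/suc q
  ⌊√⌋/n≤1/suc n q q²≤n = begin
    w * ι s                            ≡⟨ lemma₁ w (ι s) ⟩
    w * ι s * 1ℚ                       ≡⟨ cong (w * ι s *_) (1/suc-inverse q) ⟨
    w * ι s * (η * ι (suc q))          ≡⟨ lemma₂ w (ι s) η (ι (suc q)) ⟩
    η * (w * (ι s * ι (suc q)))        ≡⟨ cong (λ z → η * (w * z)) (ι-* s (suc q)) ⟨
    η * (w * ι (s ℕ.* suc q))          ≤⟨ *-monoˡ-≤ (0≤/ 1 (suc q)) (*-monoˡ-≤ (0≤/ 1 n) (ι-mono-≤ s*q≤n)) ⟩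
    η * (w * ι n)                      ≡⟨ cong (η *_) (/-*-cancel 1 n) ⟩
    η * 1ℚ                             ≡⟨ ℚ.*-identityʳ η ⟩
    η ∎
    where
    open ℚ.≤-Reasoning
    w = ℤ.+ 1 / n
    s = ⌊√ n ⌋
    η = 1/suc q
    lemma₁ : ∀ a b → a * b ≡ a * b * 1ℚ
    lemma₁ = solve-∀ ring
    lemma₂ : ∀ a b c d → a * b * (c * d) ≡ c * (a * (b * d))
    lemma₂ = solve-∀ ring
    lemma₃ : ∀ s q → s ℕ.* q ℕ.* (s ℕ.* q) ≡ s ℕ.* s ℕ.* (q ℕ.* q)
    lemma₃ = ℕ-Solver.solve-∀
    s*q≤n : s ℕ.* suc q ℕ.≤ n
    s*q≤n = ℕ.≮⇒≥ λ n< → ℕ.<⇒≱ (ℕ.*-mono-< n< n<)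
      (ℕ.≤-trans (ℕ.≤-reflexive (lemma₃ s (suc q))) (ℕ.*-mono-≤ (⌊√⌋-lower n) q²≤n))

  -- The 14 is 12 from the constant of the √n bound, 1 from the tolerance in `𝓡-≈-π`, and 1 for the
  -- gap δ′ that strict inequality of reals requires.
  mean-≈-π : ∀ δ → 0ℚ < δ → ∃[ δ′ ] 0ℚ < δ′ × (∃[ N ] ∀ n .{{_ : NonZero n}} → N ℕ.≤ n →
    ∃[ K ] ∀ k → K ℕ.≤ k →
      ∣ (ℤ.+ 1 / n) * ι (𝓡 n) - (seq π k * ½ - ι 1) ∣ + δ′ ≤ δ)
  mean-≈-π δ 0<δ = η , 0<1/suc q , suc q ℕ.* suc q , λ n q²≤n →
    let (K , near) = 𝓡-≈-π n η (0<1/suc q) in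
    K , λ k K≤k → ℚ.≤-trans
      (ℚ.+-monoˡ-≤ η (≈⇒∣-∣≤ (subst
        (λ p → (ℤ.+ 1 / n) * ι (𝓡 n) ≈ p ± (ℤ.+ 1 / n) * (ι 12 * ι ⌊√ n ⌋ + η))
        (cancel n (seq π k * ½ - ι 1))
        (≈-* (ℤ.+ 1 / n) (0≤/ 1 n) (near k K≤k)))))
      (ℚ.≤-trans (bound n q²≤n) 14η≤δ)
    where
    q = proj₁ (archimedean 14 δ 0<δ)
    14η≤δ = proj₂ (archimedean 14 δ 0<δ)
    η = 1/suc q
    cancel : ∀ n .{{_ : NonZero n}} p → (ℤ.+ 1 / n) * (p * ι n) ≡ p
    cancel n p = trans (lemma (ℤ.+ 1 / n) p (ι n))
      (trans (cong (p *_) (/-*-cancel 1 n)) (ℚ.*-identityʳ p))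
      where
      lemma : ∀ w p n → w * (p * n) ≡ p * (w * n)
      lemma = solve-∀ ring
    1/n≤1 : ∀ n .{{_ : NonZero n}} → ℤ.+ 1 / n ≤ 1ℚ
    1/n≤1 n = subst₂ _≤_ (ℚ.*-identityʳ (ℤ.+ 1 / n)) (/-*-cancel 1 n)
      (*-monoˡ-≤ (0≤/ 1 n) (ι-mono-≤ (ℕ.>-nonZero⁻¹ n)))
    bound : ∀ n .{{_ : NonZero n}} → suc q ℕ.* suc q ℕ.≤ n →
      (ℤ.+ 1 / n) * (ι 12 * ι ⌊√ n ⌋ + η) + η ≤ ι 14 * η
    bound n q²≤n = begin
      w * (ι 12 * ι ⌊√ n ⌋ + η) + η        ≡⟨ lemma₁ w (ι 12) (ι ⌊√ n ⌋) η ⟩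
      ι 12 * (w * ι ⌊√ n ⌋) + w * η + η    ≤⟨ ℚ.+-monoˡ-≤ η (ℚ.+-mono-≤
                                                (*-monoˡ-≤ (0≤ι 12) (⌊√⌋/n≤1/suc n q q²≤n))
                                                (*-mono-≤ (0≤/ 1 n) (0≤/ 1 (suc q)) (1/n≤1 n) ℚ.≤-refl)) ⟩
      ι 12 * η + 1ℚ * η + η                ≡⟨ lemma₂ (ι 12) η ⟩
      (ι 12 + 1ℚ + 1ℚ) * η                 ≡⟨⟩
      ι 14 * η ∎
      where
      open ℚ.≤-Reasoning
      w = ℤ.+ 1 / n
      lemma₁ : ∀ w t s η → w * (t * s + η) + η ≡ t * (w * s) + w * η + η
      lemma₁ = solve-∀ ring
      lemma₂ : ∀ t η → t * η + 1ℚ * η + η ≡ (t + 1ℚ + 1ℚ) * η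
      lemma₂ = solve-∀ ring

-- Transfer to real numbers

open import Defs
open import Data.Integer.Base using (+_)
open import Data.Rational.Base using (½; _/_)
open Estimates using (ι; mean-≈-π; ⌊√⌋≤√; ≈⇒∣-∣≤; 𝓡-≈-π)

proposition3p8 : ((λ n → fromℕ (𝓡 n) - (π * fromℚ ½ - fromℕ 1) * fromℕ n) ∈O (λ n → √ n))
    × ((λ n → fromℚ (+ 1 / n) * fromℕ (𝓡 n)) ⟶ π * fromℚ ½ - fromℕ 1)
proposition3p8 = bigO , limit
  where
  bigO : (λ n → fromℕ (𝓡 n) - (π * fromℚ ½ - fromℕ 1) * fromℕ n) ∈O (λ n → √ n)
  -- The ε in the definition of `_≤_` serves as the tolerance of `𝓡-≈-π`; the threshold is 0 because
  -- that bound holds for every nonzero n.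
  bigO = fromℕ 12 , 0 , λ n _ ε 0<ε →
    let (K , near) = 𝓡-≈-π n ε 0<ε in
    K , λ k K≤k → ℚ.≤-trans (≈⇒∣-∣≤ (near k K≤k))
      (ℚ.+-monoˡ-≤ ε (ℚ.*-monoˡ-≤-nonNeg (ι 12) (⌊√⌋≤√ n k)))
  limit : (λ n → fromℚ (+ 1 / n) * fromℕ (𝓡 n)) ⟶ π * fromℚ ½ - fromℕ 1
  limit ε (δ , 0<δ , K , above) =
    -- Positivity of the real ε supplies a rational δ below its terms from K on, and δ takes the
    -- place of ε.
    let (δ′ , 0<δ′ , N , near) = mean-≈-π δ 0<δ in
    N , λ n N≤n → let (K′ , near-n) = near n N≤n in
    δ′ , 0<δ′ , K ℕ.⊔ K′ , λ k K≤k → ℚ.≤-trans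
      (near-n k (ℕ.m⊔n≤o⇒n≤o K K′ K≤k))
      (subst (ℚ._≤ seq ε k) (ℚ.+-identityˡ δ) (above k (ℕ.m⊔n≤o⇒m≤o K K′ K≤k)))
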